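{- Let $A=\mathbb{F}_q[t]$, where $q$ is a power of an odd prime $p$. Let $\wp\in A$ be a monic irreducible polynomial of degree $d$, and let $\theta\in\mathbb{F}_{q^d}$ be a root of $\wp$. The following conditions are equivalent: (0) $\wp$ is a Wilson prime, i.e. $F_d\equiv -1\pmod{\wp^2}$; (i) $d^2\wp/dt^2=0$; (i') $d^2\wp/dt^2\equiv 0\pmod{\wp}$; (i'') $(d^2\wp/dt^2)|_{t=\theta}=0$; (ii) $Q_{\wp}^2(t)\equiv 0\pmod{\wp}$; (ii') $Q_{\wp}^2(t)|_{t=\theta}=0$; (iii) $\wp^{[2]}|_{t=\theta}=0$.
   Context: $F_d$ denotes the product of all nonzero polynomials in $A$ of degree less than $d$. For $a\in\mathbb{F}_{q^d}[t]$, the Fermat quotient is $Q_{\wp}(a):=(a^{q^d}-a)/\wp\in\mathbb{F}_{q^d}[t]$, and $Q_{\wp}^2(t):=Q_{\wp}(Q_{\wp}(t))$. The difference quotients are defined by $a^{[0]}=a$ and $a^{[i+1]}(t)=(a^{[i]}(t)-a^{[i]}(\theta))/(t-\theta)$; so $\wp^{[2]}=(\wp^{[1]}(t)-\wp^{[1]}(\theta))/(t-\theta)$ with $\wp^{[1]}(t)=(\wp(t)-\wp(\theta))/(t-\theta)$. Congruences modulo $\wp$ are divisibility in $\mathbb{F}_{q^d}[t]$. -}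

module Defs where

open import Level using (Level; _⊔_) renaming (suc to lsuc)
open import Algebra.Bundles using (CommutativeRing)
open import Algebra.Morphism.Structures using (module RingMorphisms)
open import Data.Nat using (ℕ; zero; suc; _≤_; _^_)
open import Data.List using (List; []; _∷_; map; foldr; filter; concatMap; length; _++_)
open import Data.List.Relation.Unary.Any using (Any)
open import Data.List.Relation.Unary.All using (All; all?)
open import Data.List.Relation.Unary.AllPairs using (AllPairs)
open import Data.Vec using (Vec; toList; replicate; zipWith; init; last) renaming (_∷_ to _∷v_; map to vmap)
open import Data.Product using (Σ; ∃; _×_; _,_; proj₁)
open import Data.Sum using (_⊎_)
open import Relation.Nullary using (¬_; ¬?)
open import Relation.Binary using (Decidable)
open import Function.Bundles using (_⇔_)

-- Univariate polynomials over a commutative ring R, represented by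
-- coefficient lists (lowest degree first), compared coefficientwise
-- (so trailing zeros are irrelevant).

module Poly {c ℓ : Level} (R : CommutativeRing c ℓ) where
  open CommutativeRing R

  Pol : Set c
  Pol = List Carrier

  coeff : Pol → ℕ → Carrier
  coeff []       _       = 0#
  coeff (a ∷ _)  zero    = a
  coeff (_ ∷ as) (suc n) = coeff as n

  _≈P_ : Pol → Pol → Set ℓ
  p ≈P q = ∀ n → coeff p n ≈ coeff q n

  0P 1P X : Pol
  0P = []
  1P = 1# ∷ []
  X  = 0# ∷ 1# ∷ []

  const : Carrier → Pol
  const a = a ∷ []

  _+P_ : Pol → Pol → Pol
  []       +P q        = q
  (a ∷ as) +P []       = a ∷ as
  (a ∷ as) +P (b ∷ bs) = (a + b) ∷ (as +P bs)

  -P_ : Pol → Pol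
  -P p = map -_ p

  _-P_ : Pol → Pol → Pol
  p -P q = p +P (-P q)

  scale : Carrier → Pol → Pol
  scale a = map (a *_)

  _*P_ : Pol → Pol → Pol
  []       *P q = []
  (a ∷ as) *P q = scale a q +P (0# ∷ (as *P q))

  _^P_ : Pol → ℕ → Pol
  p ^P zero  = 1P
  p ^P suc n = p *P (p ^P n)

  prodP : List Pol → Pol
  prodP = foldr _*P_ 1P

  eval : Pol → Carrier → Carrier
  eval []       x = 0#
  eval (a ∷ as) x = a + x * eval as x

  _∣P_ : Pol → Pol → Set (c ⊔ ℓ)
  a ∣P b = Σ Pol λ k → b ≈P (a *P k)

  DegLt : Pol → ℕ → Set ℓ
  DegLt p d = ∀ n → d ≤ n → coeff p n ≈ 0#

  -- irreducible (over a field: nonconstant, and any factorisation has a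
  -- constant factor, i.e. a unit factor)
  Irreducible : Pol → Set (c ⊔ ℓ)
  Irreducible p = (¬ DegLt p 1) × (∀ f g → p ≈P (f *P g) → DegLt f 1 ⊎ DegLt g 1)

  ntimes : ℕ → Carrier → Carrier
  ntimes zero    x = 0#
  ntimes (suc n) x = x + ntimes n x

  derivAux : ℕ → Pol → Pol
  derivAux k []       = []
  derivAux k (a ∷ as) = ntimes k a ∷ derivAux (suc k) as

  deriv : Pol → Pol
  deriv []       = []
  deriv (_ ∷ as) = derivAux 1 as

  monic : ∀ {d} → Vec Carrier d → Pol
  monic cs = toList cs ++ (1# ∷ [])

  -- Euclidean division by the monic polynomial  monic cs  :
  -- returns (quotient , remainder), the remainder as a coefficient vector
  -- of length d.  Processes f = a + t·f' from the top down:
  -- if f' = Q·m + r then  a + t·r = c·m + r'  with c the top coefficient,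
  -- hence f = (c + t·Q)·m + r'.
  divStep : ∀ {d} → Vec Carrier d → Carrier → Pol × Vec Carrier d → Pol × Vec Carrier d
  divStep cs a (Q , r) =
    let s  = a ∷v r
        ct = last s
    in (ct ∷ Q) , zipWith (λ si ci → si - ct * ci) (init s) cs

  divMod : ∀ {d} → Vec Carrier d → Pol → Pol × Vec Carrier d
  divMod {d} cs = foldr (divStep cs) ([] , replicate d 0#)

  quot : ∀ {d} → Vec Carrier d → Pol → Pol
  quot cs f = proj₁ (divMod cs f)

  diffQ : Carrier → Pol → Pol
  diffQ θ a = quot ((- θ) ∷v Data.Vec.[]) (a -P const (eval a θ))

record FiniteField (c ℓ : Level) : Set (lsuc (c ⊔ ℓ)) where
  field
    ring : CommutativeRing c ℓ
  open CommutativeRing ring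
  field
    0≉1      : ¬ (0# ≈ 1#)
    inverse  : ∀ x → ¬ (x ≈ 0#) → ∃ λ y → x * y ≈ 1#
    _≟_      : Decidable _≈_
    elements : List Carrier
    complete : ∀ x → Any (x ≈_) elements
    distinct : AllPairs (λ x y → ¬ (x ≈ y)) elements

  card : ℕ
  card = length elements

IsFieldEmbedding : ∀ {c ℓ c' ℓ'} (K : FiniteField c ℓ) (L : FiniteField c' ℓ') →
                   (CommutativeRing.Carrier (FiniteField.ring K) → CommutativeRing.Carrier (FiniteField.ring L)) →
                   Set (c ⊔ ℓ ⊔ ℓ')
IsFieldEmbedding K L ι =
  RingMorphisms.IsRingHomomorphism
    (CommutativeRing.rawRing (FiniteField.ring K))
    (CommutativeRing.rawRing (FiniteField.ring L)) ι

-- Setting of Theorem 3.  K plays F_q, L plays F_{q^d}, ι : K → L,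
-- ℘ = monic cs ∈ A = K[t] of degree d, θ ∈ L.

module Wilson {c ℓ c' ℓ'} (K : FiniteField c ℓ) (L : FiniteField c' ℓ')
              (ι : CommutativeRing.Carrier (FiniteField.ring K) → CommutativeRing.Carrier (FiniteField.ring L))
              {d : ℕ} (cs : Vec (CommutativeRing.Carrier (FiniteField.ring K)) d)
              (θ : CommutativeRing.Carrier (FiniteField.ring L)) where

  module RK = CommutativeRing (FiniteField.ring K)
  module RL = CommutativeRing (FiniteField.ring L)
  module A  = Poly (FiniteField.ring K)
  module B  = Poly (FiniteField.ring L)

  q : ℕ
  q = FiniteField.card K

  ℘ : A.Pol
  ℘ = A.monic cs

  toL : A.Pol → B.Pol
  toL = map ι

  ℘L : B.Pol
  ℘L = toL ℘

  csL : Vec RL.Carrier d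
  csL = vmap ι cs

  allPolys : ℕ → List A.Pol
  allPolys zero    = [] ∷ []
  allPolys (suc n) = concatMap (λ a → map (a ∷_) (allPolys n)) (FiniteField.elements K)

  isZeroList? : (p : A.Pol) → Relation.Nullary.Dec (All (RK._≈ RK.0#) p)
  isZeroList? = all? (λ x → FiniteField._≟_ K x RK.0#)

  F : ℕ → A.Pol
  F n = A.prodP (filter (λ p → ¬? (isZeroList? p)) (allPolys n))

  Q℘ : B.Pol → B.Pol
  Q℘ a = B.quot csL ((a B.^P (q ^ d)) B.-P a)

  Q℘²t : B.Pol
  Q℘²t = Q℘ (Q℘ B.X)

  ℘'' : A.Pol
  ℘'' = A.deriv (A.deriv ℘)

  ℘[2] : B.Pol
  ℘[2] = B.diffQ θ (B.diffQ θ ℘L)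

  Cond0 : Set (c' ⊔ ℓ')
  Cond0 = (℘L B.^P 2) B.∣P (toL (F d) B.+P B.1P)

  Cond-i : Set ℓ
  Cond-i = ℘'' A.≈P A.0P

  Cond-i' : Set (c' ⊔ ℓ')
  Cond-i' = ℘L B.∣P toL ℘''

  Cond-i'' : Set ℓ'
  Cond-i'' = B.eval (toL ℘'') θ RL.≈ RL.0#

  Cond-ii : Set (c' ⊔ ℓ')
  Cond-ii = ℘L B.∣P Q℘²t

  Cond-ii' : Set ℓ'
  Cond-ii' = B.eval Q℘²t θ RL.≈ RL.0#

  Cond-iii : Set ℓ'
  Cond-iii = B.eval ℘[2] θ RL.≈ RL.0#

  AllEquivalent : Set (ℓ ⊔ c' ⊔ ℓ')
  AllEquivalent = (Cond0 ⇔ Cond-i) × (Cond0 ⇔ Cond-i') × (Cond0 ⇔ Cond-i'')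
                × (Cond0 ⇔ Cond-ii) × (Cond0 ⇔ Cond-ii') × (Cond0 ⇔ Cond-iii)

{-# OPTIONS --safe #-}
-- Write f(θ) for the value at θ of f ∈ K[t]. By irreducibility, f(θ) = 0 iff ℘ ∣ f, and a ↦ ga mod ℘ permutes
-- the nonzero polynomials a of degree < d whenever g(θ) ≠ 0; this gives f(θ)^(q^d) = f(θ) and F_d(θ) = −1.
-- So ℘ divides F_d + 1, and ℘² does iff F_d′(θ) = 0, i.e. iff S = Σ a′(θ)/a(θ) vanishes. For a linear g,
-- ga = λ(a) ℘ + (ga mod ℘) with λ(a) constant. Differentiating once and twice at θ, dividing by a(θ) and summing
-- over a, with Λ = Σ λ(a)/a(θ), the permuted sums cancel and leave ℘′(θ) Λ = −1 and ℘″(θ) Λ = 2S. Hence (0) ⇔ (i″).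
-- For (ii), differentiate ℘ Q = t^(q^d) − t twice and ℘ Q(Q) = Q^(q^d) − Q once at θ;
-- for (iii), ℘″(θ) = 2 ℘^[2](θ).
module Submission where

-- A linear g is chosen because g a then has degree at most `d`: the quotient λ(a) is a constant and
-- contributes no derivative, while g′ = 1 leaves exactly a after one differentiation and 2a′ after
-- two. The weights 1/a(θ) make the sums cancel: the residue r of g a has r(θ) = g(θ) a(θ), so
-- r′(θ)/a(θ) = g(θ) r′(θ)/r(θ), and summing over a reproduces g(θ) S because r runs through the
-- same polynomials as a; second derivatives behave alike. The -1 is the number of terms, q^d - 1,
-- since Σ a(θ)/a(θ) counts them. It also makes ℘′(θ) and Λ invertible, so separability of `℘` comes
-- out of the same sum. Oddness of q serves to cancel the factor 2 in 2S, in 2 ℘′(θ) Q′(θ) and in 2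
-- ℘^[2](θ). Irreducibility is given over `K`, so most computations take place in K[t] and only
-- their values at `θ` lie in `L`; the Fermat quotients over `L` are identified with those over `K`
-- by uniqueness of division by a monic polynomial.

open import Defs
open import Algebra.Bundles using (CommutativeMonoid; CommutativeRing; RawRing)
open import Algebra.Morphism.Structures using (module RingMorphisms)
open import Algebra.Solver.Ring.AlmostCommutativeRing using (fromCommutativeRing; _-Raw-AlmostCommutative⟶_)
open import Data.Empty using (⊥; ⊥-elim)
open import Data.List using (List; []; _∷_; map; foldr; length; filter; concatMap)
open import Data.List.Properties using (length-removeAt′; length-++; length-map; filter-all)
open import Data.List.Relation.Unary.All as All using (All; []; _∷_)
open import Data.List.Relation.Unary.AllPairs as AllPairs using (AllPairs; []; _∷_)
open import Data.List.Relation.Unary.Any as Any using (Any; here; there; index; _─_)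
open import Data.Maybe using (Maybe; just; nothing)
open import Data.Nat as ℕ using (ℕ; zero; suc; _≤_; _<_; z≤n; s≤s; _^_)
open import Data.Nat.Divisibility using (_∣_; divides; ∣1⇒≡1)
open import Data.Nat.DivMod using (_/_; _%_; m≡m%n+[m/n]*n; m%n<n)
open import Data.Nat.Primality using (Prime; euclidsLemma; prime[2]; prime⇒irreducible)
open import Data.Product using (Σ; _×_; _,_; proj₁; proj₂)
open import Data.Sum using (_⊎_; inj₁; inj₂)
open import Data.Vec as Vec using (Vec; toList; init; last; zipWith)
open import Function.Bundles using (_⇔_; mk⇔)
open import Function.Construct.Composition using (_⇔-∘_)
open import Function.Properties.Equivalence using () renaming (sym to ⇔-sym)
open import Relation.Binary using (IsEquivalence; Setoid)
open import Relation.Binary.PropositionalEquality as ≡ using (_≡_; _≢_)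
open import Relation.Nullary using (¬_; ¬?; Dec; yes; no)
import Algebra.Properties.CommutativeSemigroup
import Algebra.Properties.Monoid.Mult
import Algebra.Properties.Ring
import Algebra.Properties.Semiring.Exp
import Algebra.Properties.Semiring.Mult
import Algebra.Solver.Ring
import Data.List.Relation.Unary.All.Properties as Allₚ
import Data.List.Relation.Unary.AllPairs.Properties as AllPairsₚ
import Data.List.Relation.Unary.Any.Properties as Anyₚ
import Data.Nat.Properties as ℕₚ
import Relation.Binary.Reasoning.Setoid

-- The stdlib ring solver with coefficients m − n, encoded as pairs (m , n), so that
-- cancellation is detected in an arbitrary commutative ring (except between numerals in a constant term).
module DifferenceSolver {c ℓ} (R : CommutativeRing c ℓ) where
  open CommutativeRing R
  open Algebra.Properties.Ring ring
  open Algebra.Properties.Semiring.Mult semiring renaming (_×_ to _·_)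
  open Relation.Binary.Reasoning.Setoid setoid

  private
    Coeff : RawRing _ _
    Coeff = record
      { Carrier = ℕ × ℕ
      ; _≈_ = _≡_
      ; _+_ = λ (a , b) (a' , b') → a ℕ.+ a' , b ℕ.+ b'
      ; _*_ = λ (a , b) (a' , b') → a ℕ.* a' ℕ.+ b ℕ.* b' , a ℕ.* b' ℕ.+ b ℕ.* a'
      ; -_  = λ (a , b) → b , a
      ; 0#  = 0 , 0
      ; 1#  = 1 , 0
      }

    -- Defined so that ⟦ 0 , 0 ⟧ and ⟦ 1 , 0 ⟧ are 0# and 1# on the nose.
    ⟦_⟧ : ℕ × ℕ → Carrier
    ⟦ 0 , 0 ⟧ = 0#
    ⟦ 1 , 0 ⟧ = 1#
    ⟦ a , b ⟧ = a · 1# - b · 1#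

    ⟦⟧-def : ∀ a b → ⟦ a , b ⟧ ≈ a · 1# - b · 1#
    ⟦⟧-def 0             0       = sym (-‿inverseʳ 0#)
    ⟦⟧-def 1             0       = sym (trans (+-cong (+-identityʳ 1#) -0#≈0#) (+-identityʳ 1#))
    ⟦⟧-def (suc (suc a)) 0       = refl
    ⟦⟧-def 0             (suc b) = refl
    ⟦⟧-def 1             (suc b) = refl
    ⟦⟧-def (suc (suc a)) (suc b) = refl

    interchange : ∀ a b x y → (a + x) + (b + y) ≈ (a + b) + (x + y)
    interchange a b x y = begin
      (a + x) + (b + y)  ≈⟨ +-assoc _ _ _ ⟩
      a + (x + (b + y))  ≈⟨ +-congˡ (sym (+-assoc _ _ _)) ⟩
      a + ((x + b) + y)  ≈⟨ +-congˡ (+-congʳ (+-comm _ _)) ⟩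
      a + ((b + x) + y)  ≈⟨ +-congˡ (+-assoc _ _ _) ⟩
      a + (b + (x + y))  ≈⟨ sym (+-assoc _ _ _) ⟩
      (a + b) + (x + y)  ∎

    +-homo : ∀ a b x y → (a ℕ.+ x) · 1# - (b ℕ.+ y) · 1# ≈ (a · 1# - b · 1#) + (x · 1# - y · 1#)
    +-homo a b x y = begin
      (a ℕ.+ x) · 1# - (b ℕ.+ y) · 1#
        ≈⟨ +-cong (×-homo-+ 1# a x) (trans (-‿cong (×-homo-+ 1# b y)) (sym (-‿+-comm _ _))) ⟩
      (a · 1# + x · 1#) + (- (b · 1#) - y · 1#)
        ≈⟨ interchange _ _ _ _ ⟩
      (a · 1# - b · 1#) + (x · 1# - y · 1#) ∎

    *-homo : ∀ a b x y → (a ℕ.* x ℕ.+ b ℕ.* y) · 1# - (a ℕ.* y ℕ.+ b ℕ.* x) · 1#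
                         ≈ (a · 1# - b · 1#) * (x · 1# - y · 1#)
    *-homo a b x y = begin
      (a ℕ.* x ℕ.+ b ℕ.* y) · 1# - (a ℕ.* y ℕ.+ b ℕ.* x) · 1#
        ≈⟨ +-homo (a ℕ.* x) (a ℕ.* y) (b ℕ.* y) (b ℕ.* x) ⟩
      ((a ℕ.* x) · 1# - (a ℕ.* y) · 1#) + ((b ℕ.* y) · 1# - (b ℕ.* x) · 1#)
        ≈⟨ +-cong (+-cong (×1-homo-* a x) (-‿cong (×1-homo-* a y)))
                  (trans (+-cong (×1-homo-* b y) (-‿cong (×1-homo-* b x))) (+-comm _ _)) ⟩
      (A * X - A * Y) + (- (B * X) + B * Y)
        ≈⟨ +-cong (+-congˡ (-‿distribʳ-* A Y))
                  (+-cong (-‿distribˡ-* B X)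
                          (trans (sym (-‿involutive _)) (trans (-‿cong (-‿distribʳ-* B Y)) (-‿distribˡ-* B (- Y))))) ⟩
      (A * X + A * - Y) + (- B * X + - B * - Y)
        ≈⟨ +-cong (sym (distribˡ _ _ _)) (sym (distribˡ _ _ _)) ⟩
      A * (X - Y) + - B * (X - Y)
        ≈⟨ sym (distribʳ _ _ _) ⟩
      (A - B) * (X - Y) ∎
      where
      A = a · 1#
      B = b · 1#
      X = x · 1#
      Y = y · 1#

    morphism : Coeff -Raw-AlmostCommutative⟶ fromCommutativeRing R
    morphism = record
      { ⟦_⟧    = ⟦_⟧
      ; +-homo = λ (a , b) (x , y) → trans (⟦⟧-def (a ℕ.+ x) (b ℕ.+ y))
          (trans (+-homo a b x y) (sym (+-cong (⟦⟧-def a b) (⟦⟧-def x y))))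
      ; *-homo = λ (a , b) (x , y) → trans (⟦⟧-def (a ℕ.* x ℕ.+ b ℕ.* y) (a ℕ.* y ℕ.+ b ℕ.* x))
          (trans (*-homo a b x y) (sym (*-cong (⟦⟧-def a b) (⟦⟧-def x y))))
      ; -‿homo = λ (a , b) → trans (⟦⟧-def b a)
          (trans (trans (trans (+-comm _ _) (+-congˡ (sym (-‿involutive _)))) (-‿+-comm _ _))
                 (-‿cong (sym (⟦⟧-def a b))))
      ; 0-homo = refl
      ; 1-homo = refl
      }

    -- Cross addition compares the integers a - b and x - y; comparing the pairs themselves would
    -- miss that (1 , 1) denotes 0.
    coeff≟ : ∀ x y → Maybe (⟦ x ⟧ ≈ ⟦ y ⟧)
    coeff≟ (a , b) (x , y) with a ℕ.+ y ℕ.≟ x ℕ.+ b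
    ... | no _   = nothing
    ... | yes eq = just (trans (⟦⟧-def a b) (trans (begin
      a · 1# - b · 1#
        ≈⟨ +-congˡ (sym (trans (+-congˡ (-‿inverseˡ _)) (+-identityʳ _))) ⟩
      a · 1# + (- (b · 1#) + (- (y · 1#) + y · 1#))
        ≈⟨ +-congˡ (trans (sym (+-assoc _ _ _)) (+-comm _ _)) ⟩
      a · 1# + (y · 1# + (- (b · 1#) - y · 1#))
        ≈⟨ sym (+-assoc _ _ _) ⟩
      (a · 1# + y · 1#) + (- (b · 1#) - y · 1#)
        ≈⟨ +-congʳ (trans (sym (×-homo-+ 1# a y)) (trans (reflexive (≡.cong (_· 1#) eq)) (×-homo-+ 1# x b))) ⟩
      (x · 1# + b · 1#) + (- (b · 1#) - y · 1#)
        ≈⟨ +-assoc _ _ _ ⟩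
      x · 1# + (b · 1# + (- (b · 1#) - y · 1#))
        ≈⟨ +-congˡ (trans (sym (+-assoc _ _ _)) (trans (+-congʳ (-‿inverseʳ _)) (+-identityˡ _))) ⟩
      x · 1# - y · 1# ∎) (sym (⟦⟧-def x y))))

  open Algebra.Solver.Ring Coeff (fromCommutativeRing R) morphism coeff≟ public
    using (solve; _:+_; _:*_; _:-_; :-_; _:=_; con; Polynomial)

  :0 :1 : ∀ {n} → Polynomial n
  :0 = con (0 , 0)
  :1 = con (1 , 0)

-- Coefficient lists as a commutative ring; evaluation and formal derivatives.

module PolyTheory {c ℓ} (R : CommutativeRing c ℓ) where
  open CommutativeRing R
  open Poly R
  open Algebra.Properties.Ring ring using (-0#≈0#)
  open Algebra.Properties.Monoid.Mult +-monoid using () renaming (_×_ to _·_)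
  private
    module ≈-R = Relation.Binary.Reasoning.Setoid setoid
    module S = DifferenceSolver R

  -- Wrapped so that both sides can be inferred from the type of a proof.
  infix 4 _≋_
  record _≋_ (p q : Pol) : Set ℓ where
    constructor ⟪_⟫
    field at : p ≈P q
  open _≋_ public

  ≋-refl : ∀ {p} → p ≋ p
  ≋-refl = ⟪ (λ _ → refl) ⟫

  ≋-sym : ∀ {p q} → p ≋ q → q ≋ p
  ≋-sym e = ⟪ (λ n → sym (at e n)) ⟫

  ≋-trans : ∀ {p q r} → p ≋ q → q ≋ r → p ≋ r
  ≋-trans e f = ⟪ (λ n → trans (at e n) (at f n)) ⟫

  ≋-isEquivalence : IsEquivalence _≋_
  ≋-isEquivalence = record { refl = ≋-refl ; sym = ≋-sym ; trans = ≋-trans }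

  coeff-+ : ∀ p q n → coeff (p +P q) n ≈ coeff p n + coeff q n
  coeff-+ []       q        n       = sym (+-identityˡ _)
  coeff-+ (a ∷ as) []       n       = sym (+-identityʳ _)
  coeff-+ (a ∷ as) (b ∷ bs) zero    = refl
  coeff-+ (a ∷ as) (b ∷ bs) (suc n) = coeff-+ as bs n

  coeff-neg : ∀ p n → coeff (-P p) n ≈ - coeff p n
  coeff-neg []       n       = sym -0#≈0#
  coeff-neg (a ∷ as) zero    = refl
  coeff-neg (a ∷ as) (suc n) = coeff-neg as n

  coeff-scale : ∀ a p n → coeff (scale a p) n ≈ a * coeff p n
  coeff-scale a []       n       = sym (zeroʳ a)
  coeff-scale a (b ∷ bs) zero    = refl
  coeff-scale a (b ∷ bs) (suc n) = coeff-scale a bs n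

  ∷-cong : ∀ {a b p q} → a ≈ b → p ≋ q → (a ∷ p) ≋ (b ∷ q)
  ∷-cong a≈b p≋q = ⟪ (λ { zero → a≈b ; (suc n) → at p≋q n }) ⟫

  ∷-tail : ∀ {a b p q} → (a ∷ p) ≋ (b ∷ q) → p ≋ q
  ∷-tail e = ⟪ (λ n → at e (suc n)) ⟫

  ∷-tail-[] : ∀ {a p} → (a ∷ p) ≋ [] → p ≋ []
  ∷-tail-[] e = ⟪ (λ n → at e (suc n)) ⟫

  shift-[] : (0# ∷ []) ≋ []
  shift-[] = ⟪ (λ { zero → refl ; (suc n) → refl }) ⟫

  +P-cong : ∀ {p p' q q'} → p ≋ p' → q ≋ q' → (p +P q) ≋ (p' +P q')
  +P-cong {p} {p'} {q} {q'} e f = ⟪ (λ n →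
    trans (coeff-+ p q n) (trans (+-cong (at e n) (at f n)) (sym (coeff-+ p' q' n)))) ⟫

  +P-assoc : ∀ p q r → ((p +P q) +P r) ≋ (p +P (q +P r))
  +P-assoc p q r = ⟪ (λ n → let open ≈-R in begin
    coeff ((p +P q) +P r) n              ≈⟨ coeff-+ (p +P q) r n ⟩
    coeff (p +P q) n + coeff r n         ≈⟨ +-congʳ (coeff-+ p q n) ⟩
    (coeff p n + coeff q n) + coeff r n  ≈⟨ +-assoc _ _ _ ⟩
    coeff p n + (coeff q n + coeff r n)  ≈⟨ +-congˡ (sym (coeff-+ q r n)) ⟩
    coeff p n + coeff (q +P r) n         ≈⟨ sym (coeff-+ p (q +P r) n) ⟩
    coeff (p +P (q +P r)) n              ∎) ⟫

  +P-comm : ∀ p q → (p +P q) ≋ (q +P p)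
  +P-comm p q = ⟪ (λ n → trans (coeff-+ p q n) (trans (+-comm _ _) (sym (coeff-+ q p n)))) ⟫

  +P-identityʳ : ∀ p → (p +P []) ≋ p
  +P-identityʳ p = +P-comm p []

  -P-cong : ∀ {p q} → p ≋ q → (-P p) ≋ (-P q)
  -P-cong {p} {q} e = ⟪ (λ n → trans (coeff-neg p n) (trans (-‿cong (at e n)) (sym (coeff-neg q n)))) ⟫

  -P-inverseʳ : ∀ p → (p +P (-P p)) ≋ []
  -P-inverseʳ p = ⟪ (λ n → trans (coeff-+ p (-P p) n) (trans (+-congˡ (coeff-neg p n)) (-‿inverseʳ _))) ⟫

  +P-interchange : ∀ p q r s → ((p +P q) +P (r +P s)) ≋ ((p +P r) +P (q +P s))
  +P-interchange p q r s =
    ≋-trans (+P-assoc p q (r +P s))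
    (≋-trans (+P-cong {p = p} ≋-refl (≋-trans (≋-sym (+P-assoc q r s)) (≋-trans (+P-cong (+P-comm q r) ≋-refl) (+P-assoc r q s))))
    (≋-sym (+P-assoc p r (q +P s))))

  +P-exchange : ∀ p q r → (p +P (q +P r)) ≋ (q +P (p +P r))
  +P-exchange p q r =
    ≋-trans (≋-sym (+P-assoc p q r)) (≋-trans (+P-cong (+P-comm p q) ≋-refl) (+P-assoc q p r))

  scale-cong : ∀ {a b p q} → a ≈ b → p ≋ q → scale a p ≋ scale b q
  scale-cong {a} {b} {p} {q} a≈b e = ⟪ (λ n →
    trans (coeff-scale a p n) (trans (*-cong a≈b (at e n)) (sym (coeff-scale b q n)))) ⟫

  scale-+P : ∀ a p q → scale a (p +P q) ≋ (scale a p +P scale a q)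
  scale-+P a p q = ⟪ (λ n → let open ≈-R in begin
    coeff (scale a (p +P q)) n                 ≈⟨ coeff-scale a (p +P q) n ⟩
    a * coeff (p +P q) n                       ≈⟨ *-congˡ (coeff-+ p q n) ⟩
    a * (coeff p n + coeff q n)                ≈⟨ distribˡ _ _ _ ⟩
    a * coeff p n + a * coeff q n              ≈⟨ sym (+-cong (coeff-scale a p n) (coeff-scale a q n)) ⟩
    coeff (scale a p) n + coeff (scale a q) n  ≈⟨ sym (coeff-+ (scale a p) (scale a q) n) ⟩
    coeff (scale a p +P scale a q) n           ∎) ⟫

  +-scale : ∀ a b p → scale (a + b) p ≋ (scale a p +P scale b p)
  +-scale a b p = ⟪ (λ n → let open ≈-R in begin
    coeff (scale (a + b) p) n                  ≈⟨ coeff-scale (a + b) p n ⟩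
    (a + b) * coeff p n                        ≈⟨ distribʳ _ _ _ ⟩
    a * coeff p n + b * coeff p n              ≈⟨ sym (+-cong (coeff-scale a p n) (coeff-scale b p n)) ⟩
    coeff (scale a p) n + coeff (scale b p) n  ≈⟨ sym (coeff-+ (scale a p) (scale b p) n) ⟩
    coeff (scale a p +P scale b p) n           ∎) ⟫

  *-scale : ∀ a b p → scale (a * b) p ≋ scale a (scale b p)
  *-scale a b p = ⟪ (λ n → trans (coeff-scale (a * b) p n) (trans (*-assoc _ _ _)
    (sym (trans (coeff-scale a (scale b p) n) (*-congˡ (coeff-scale b p n)))))) ⟫

  0-scale : ∀ p → scale 0# p ≋ []
  0-scale p = ⟪ (λ n → trans (coeff-scale 0# p n) (zeroˡ _)) ⟫

  1-scale : ∀ p → scale 1# p ≋ p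
  1-scale p = ⟪ (λ n → trans (coeff-scale 1# p n) (*-identityˡ _)) ⟫

  *P-congˡ : ∀ p {q q'} → q ≋ q' → (p *P q) ≋ (p *P q')
  *P-congˡ []       e = ≋-refl
  *P-congˡ (a ∷ as) e = +P-cong (scale-cong refl e) (∷-cong refl (*P-congˡ as e))

  -- Equal polynomials may be lists of different lengths. In `*P-congʳ` one list can therefore run
  -- out while the other still carries zeros, and this covers that case.
  ≋[]-*P : ∀ p q → p ≋ [] → (p *P q) ≋ []
  ≋[]-*P []       q e = ≋-refl
  ≋[]-*P (a ∷ as) q e =
    +P-cong {p' = []} {q' = []} (≋-trans (scale-cong (at e 0) ≋-refl) (0-scale q))
            (≋-trans (∷-cong refl (≋[]-*P as q (∷-tail-[] e))) shift-[])

  *P-congʳ : ∀ p p' q → p ≋ p' → (p *P q) ≋ (p' *P q)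
  *P-congʳ []       p'       q e = ≋-sym (≋[]-*P p' q (≋-sym e))
  *P-congʳ (a ∷ as) []       q e = ≋[]-*P (a ∷ as) q e
  *P-congʳ (a ∷ as) (b ∷ bs) q e =
    +P-cong (scale-cong (at e 0) ≋-refl) (∷-cong refl (*P-congʳ as bs q (∷-tail e)))

  *P-zeroʳ : ∀ p → (p *P []) ≋ []
  *P-zeroʳ []       = ≋-refl
  *P-zeroʳ (a ∷ as) = ≋-trans (∷-cong refl (*P-zeroʳ as)) shift-[]

  -- `_*P_` recurses on its left factor; this is the mirrored recursion, which makes commutativity a
  -- plain induction.
  *P-∷ʳ : ∀ p b q → (p *P (b ∷ q)) ≋ (scale b p +P (0# ∷ (p *P q)))
  *P-∷ʳ []       b q = ≋-sym shift-[]
  *P-∷ʳ (a ∷ as) b q = ∷-cong (+-congʳ (*-comm a b))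
    (≋-trans (+P-cong ≋-refl (*P-∷ʳ as b q)) (+P-exchange (scale a q) (scale b as) (0# ∷ (as *P q))))

  *P-comm : ∀ p q → (p *P q) ≋ (q *P p)
  *P-comm p []       = *P-zeroʳ p
  *P-comm p (b ∷ q) = ≋-trans (*P-∷ʳ p b q) (+P-cong ≋-refl (∷-cong refl (*P-comm p q)))

  *P-distribʳ : ∀ r p q → ((p +P q) *P r) ≋ ((p *P r) +P (q *P r))
  *P-distribʳ r []       q        = ≋-refl
  *P-distribʳ r (a ∷ as) []       = ≋-sym (+P-identityʳ _)
  *P-distribʳ r (a ∷ as) (b ∷ bs) = ≋-trans
    (+P-cong (+-scale a b r)
      (≋-trans (∷-cong (sym (+-identityˡ 0#)) (*P-distribʳ r as bs)) ≋-refl))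
    (+P-interchange (scale a r) (scale b r) (0# ∷ (as *P r)) (0# ∷ (bs *P r)))

  scale-*P : ∀ a p q → (scale a p *P q) ≋ scale a (p *P q)
  scale-*P a []       q = ≋-refl
  scale-*P a (b ∷ bs) q = ≋-trans
    (+P-cong (*-scale a b q) (∷-cong (sym (zeroʳ a)) (scale-*P a bs q)))
    (≋-sym (scale-+P a (scale b q) (0# ∷ (bs *P q))))

  shift-*P : ∀ p q → ((0# ∷ p) *P q) ≋ (0# ∷ (p *P q))
  shift-*P p q = +P-cong {p' = []} (0-scale q) ≋-refl

  *P-assoc : ∀ p q r → ((p *P q) *P r) ≋ (p *P (q *P r))
  *P-assoc []       q r = ≋-refl
  *P-assoc (a ∷ as) q r = ≋-trans (*P-distribʳ r (scale a q) (0# ∷ (as *P q)))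
    (+P-cong (scale-*P a q r) (≋-trans (shift-*P (as *P q) r) (∷-cong refl (*P-assoc as q r))))

  *P-identityˡ : ∀ p → (1P *P p) ≋ p
  *P-identityˡ p = ≋-trans (+P-cong {q' = []} (1-scale p) shift-[]) (+P-identityʳ p)

  polyRing : CommutativeRing c ℓ
  polyRing = record
    { Carrier = Pol
    ; _≈_     = _≋_
    ; _+_     = _+P_
    ; _*_     = _*P_
    ; -_      = -P_
    ; 0#      = []
    ; 1#      = 1P
    ; isCommutativeRing = record
      { isRing = record
        { +-isAbelianGroup = record
          { isGroup = record
            { isMonoid = record
              { isSemigroup = record
                { isMagma = record { isEquivalence = ≋-isEquivalence ; ∙-cong = +P-cong }
                ; assoc   = +P-assoc }
              ; identity = (λ p → ≋-refl) , +P-identityʳ }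
            ; inverse = (λ p → ≋-trans (+P-comm (-P p) p) (-P-inverseʳ p)) , -P-inverseʳ
            ; ⁻¹-cong = -P-cong }
          ; comm = +P-comm }
        ; *-cong     = λ {p} {p'} {q} {q'} e f → ≋-trans (*P-congʳ p p' q e) (*P-congˡ p' f)
        ; *-assoc    = *P-assoc
        ; *-identity = *P-identityˡ , (λ p → ≋-trans (*P-comm p 1P) (*P-identityˡ p))
        ; distrib    = (λ r p q → ≋-trans (*P-comm r (p +P q)) (≋-trans (*P-distribʳ r p q)
                                    (+P-cong (*P-comm p r) (*P-comm q r))))
                     , *P-distribʳ }
      ; *-comm = *P-comm }
    }

  private
    module P = CommutativeRing polyRing
    module PS = DifferenceSolver polyRing
    module ≋-R = Relation.Binary.Reasoning.Setoid P.setoid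

  eval-≋[] : ∀ p x → p ≋ [] → eval p x ≈ 0#
  eval-≋[] []       x e = refl
  eval-≋[] (a ∷ as) x e = trans (+-cong (at e 0) (*-congˡ (eval-≋[] as x (∷-tail-[] e))))
                                (trans (+-identityˡ _) (zeroʳ x))

  eval-cong : ∀ p q x → p ≋ q → eval p x ≈ eval q x
  eval-cong []       q        x e = sym (eval-≋[] q x (≋-sym e))
  eval-cong (a ∷ as) []       x e = eval-≋[] (a ∷ as) x e
  eval-cong (a ∷ as) (b ∷ bs) x e = +-cong (at e 0) (*-congˡ (eval-cong as bs x (∷-tail e)))

  eval-+ : ∀ p q x → eval (p +P q) x ≈ eval p x + eval q x
  eval-+ []       q        x = sym (+-identityˡ _)
  eval-+ (a ∷ as) []       x = sym (+-identityʳ _)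
  eval-+ (a ∷ as) (b ∷ bs) x = trans (+-congˡ (*-congˡ (eval-+ as bs x)))
    (S.solve 5 (λ a b x u v → (a :+ b) :+ x :* (u :+ v) := (a :+ x :* u) :+ (b :+ x :* v))
       refl a b x (eval as x) (eval bs x))
    where open S

  eval-scale : ∀ a p x → eval (scale a p) x ≈ a * eval p x
  eval-scale a []       x = sym (zeroʳ a)
  eval-scale a (b ∷ bs) x = trans (+-congˡ (*-congˡ (eval-scale a bs x)))
    (S.solve 4 (λ a b x u → a :* b :+ x :* (a :* u) := a :* (b :+ x :* u)) refl a b x (eval bs x))
    where open S

  eval-neg : ∀ p x → eval (-P p) x ≈ - eval p x
  eval-neg []       x = sym -0#≈0#
  eval-neg (b ∷ bs) x = trans (+-congˡ (*-congˡ (eval-neg bs x)))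
    (S.solve 3 (λ b x u → :- b :+ x :* (:- u) := :- (b :+ x :* u)) refl b x (eval bs x))
    where open S

  eval-* : ∀ p q x → eval (p *P q) x ≈ eval p x * eval q x
  eval-* []       q x = sym (zeroˡ _)
  eval-* (a ∷ as) q x = begin
    eval (scale a q +P (0# ∷ (as *P q))) x           ≈⟨ eval-+ (scale a q) (0# ∷ (as *P q)) x ⟩
    eval (scale a q) x + (0# + x * eval (as *P q) x) ≈⟨ +-cong (eval-scale a q x) (+-congˡ (*-congˡ (eval-* as q x))) ⟩
    a * eval q x + (0# + x * (eval as x * eval q x)) ≈⟨ S.solve 4 (λ a x u v →
        a :* v :+ (:0 :+ x :* (u :* v)) := (a :+ x :* u) :* v) refl a x (eval as x) (eval q x) ⟩
    (a + x * eval as x) * eval q x                   ∎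
    where open ≈-R
          open S

  eval-const : ∀ a x → eval (const a) x ≈ a
  eval-const a x = trans (+-congˡ (zeroʳ x)) (+-identityʳ a)

  ntimes-cong : ∀ n {x y} → x ≈ y → ntimes n x ≈ ntimes n y
  ntimes-cong zero    e = refl
  ntimes-cong (suc n) e = +-cong e (ntimes-cong n e)

  ntimes-0 : ∀ n → ntimes n 0# ≈ 0#
  ntimes-0 zero    = refl
  ntimes-0 (suc n) = trans (+-identityˡ _) (ntimes-0 n)

  ntimes-+ : ∀ n x y → ntimes n (x + y) ≈ ntimes n x + ntimes n y
  ntimes-+ zero    x y = sym (+-identityˡ 0#)
  ntimes-+ (suc n) x y = trans (+-congˡ (ntimes-+ n x y))
    (S.solve 4 (λ x y u v → x :+ y :+ (u :+ v) := x :+ u :+ (y :+ v)) refl x y _ _)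
    where open S

  ntimes-+ˡ : ∀ m n x → ntimes (m ℕ.+ n) x ≈ ntimes m x + ntimes n x
  ntimes-+ˡ zero    n x = sym (+-identityˡ _)
  ntimes-+ˡ (suc m) n x = trans (+-congˡ (ntimes-+ˡ m n x)) (sym (+-assoc _ _ _))

  ntimes-1-* : ∀ m n → ntimes (m ℕ.* n) 1# ≈ ntimes m 1# * ntimes n 1#
  ntimes-1-* zero    n = sym (zeroˡ _)
  ntimes-1-* (suc m) n = begin
    ntimes (n ℕ.+ m ℕ.* n) 1#                   ≈⟨ ntimes-+ˡ n (m ℕ.* n) 1# ⟩
    ntimes n 1# + ntimes (m ℕ.* n) 1#           ≈⟨ +-congˡ (ntimes-1-* m n) ⟩
    ntimes n 1# + ntimes m 1# * ntimes n 1#     ≈⟨ S.solve 2 (λ x y → x :+ y :* x := (:1 :+ y) :* x) refl _ _ ⟩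
    (1# + ntimes m 1#) * ntimes n 1#            ∎
    where open ≈-R
          open S

  ×≈ntimes : ∀ n x → n · x ≈ ntimes n x
  ×≈ntimes zero    x = refl
  ×≈ntimes (suc n) x = +-congˡ (×≈ntimes n x)

  coeff-derivAux : ∀ k p n → coeff (derivAux k p) n ≈ ntimes (k ℕ.+ n) (coeff p n)
  coeff-derivAux k []       n       = sym (ntimes-0 (k ℕ.+ n))
  coeff-derivAux k (a ∷ as) zero    = reflexive (≡.cong (λ m → ntimes m a) (≡.sym (ℕₚ.+-identityʳ k)))
  coeff-derivAux k (a ∷ as) (suc n) = trans (coeff-derivAux (suc k) as n)
    (reflexive (≡.cong (λ m → ntimes m (coeff as n)) (≡.sym (ℕₚ.+-suc k n))))

  coeff-deriv : ∀ p n → coeff (deriv p) n ≈ ntimes (suc n) (coeff p (suc n))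
  coeff-deriv []       n = sym (ntimes-0 (suc n))
  coeff-deriv (a ∷ as) n = coeff-derivAux 1 as n

  deriv-cong : ∀ {p q} → p ≋ q → deriv p ≋ deriv q
  deriv-cong {p} {q} e = ⟪ (λ n → trans (coeff-deriv p n)
    (trans (ntimes-cong (suc n) (at e (suc n))) (sym (coeff-deriv q n)))) ⟫

  deriv-+ : ∀ p q → deriv (p +P q) ≋ (deriv p +P deriv q)
  deriv-+ p q = ⟪ (λ n → let open ≈-R in begin
    coeff (deriv (p +P q)) n
      ≈⟨ coeff-deriv (p +P q) n ⟩
    ntimes (suc n) (coeff (p +P q) (suc n))
      ≈⟨ ntimes-cong (suc n) (coeff-+ p q (suc n)) ⟩
    ntimes (suc n) (coeff p (suc n) + coeff q (suc n))
      ≈⟨ ntimes-+ (suc n) _ _ ⟩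
    ntimes (suc n) (coeff p (suc n)) + ntimes (suc n) (coeff q (suc n))
      ≈⟨ sym (+-cong (coeff-deriv p n) (coeff-deriv q n)) ⟩
    coeff (deriv p) n + coeff (deriv q) n
      ≈⟨ sym (coeff-+ (deriv p) (deriv q) n) ⟩
    coeff (deriv p +P deriv q) n ∎) ⟫

  deriv-neg : ∀ p → deriv (-P p) ≋ (-P deriv p)
  deriv-neg p = begin
    deriv (-P p)                                      ≈⟨ PS.solve 2 (λ x y → y := x :+ y :- x) ≋-refl (deriv p) _ ⟩
    (deriv p +P deriv (-P p)) +P (-P deriv p)         ≈⟨ P.+-congʳ { -P deriv p} (≋-sym (deriv-+ p (-P p))) ⟩
    deriv (p +P (-P p)) +P (-P deriv p)               ≈⟨ P.+-congʳ { -P deriv p} (deriv-cong (-P-inverseʳ p)) ⟩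
    -P deriv p                                        ∎
    where open ≋-R
          open PS

  deriv-∷ : ∀ a p → deriv (a ∷ p) ≋ (p +P (0# ∷ deriv p))
  deriv-∷ a p = ⟪ (λ { zero    → trans (coeff-deriv (a ∷ p) 0) (sym (coeff-+ p (0# ∷ deriv p) 0))
                     ; (suc n) → trans (coeff-deriv (a ∷ p) (suc n))
                         (trans (+-congˡ (sym (coeff-deriv p n))) (sym (coeff-+ p (0# ∷ deriv p) (suc n)))) }) ⟫

  deriv-scale : ∀ a p → deriv (scale a p) ≋ scale a (deriv p)
  deriv-scale a p = ⟪ (λ n → let open ≈-R in begin
    coeff (deriv (scale a p)) n              ≈⟨ coeff-deriv (scale a p) n ⟩
    ntimes (suc n) (coeff (scale a p) (suc n)) ≈⟨ ntimes-cong (suc n) (coeff-scale a p (suc n)) ⟩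
    ntimes (suc n) (a * coeff p (suc n))     ≈⟨ ntimes-* (suc n) a _ ⟩
    a * ntimes (suc n) (coeff p (suc n))     ≈⟨ *-congˡ (sym (coeff-deriv p n)) ⟩
    a * coeff (deriv p) n                    ≈⟨ sym (coeff-scale a (deriv p) n) ⟩
    coeff (scale a (deriv p)) n              ∎) ⟫
    where
    ntimes-* : ∀ n a x → ntimes n (a * x) ≈ a * ntimes n x
    ntimes-* zero    a x = sym (zeroʳ a)
    ntimes-* (suc n) a x = trans (+-congˡ (ntimes-* n a x)) (sym (distribˡ _ _ _))

  deriv-* : ∀ p q → deriv (p *P q) ≋ ((deriv p *P q) +P (p *P deriv q))
  deriv-* []       q = ≋-refl
  deriv-* (a ∷ as) q = begin
    deriv (scale a q +P (0# ∷ (as *P q)))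
      ≈⟨ deriv-+ (scale a q) _ ⟩
    deriv (scale a q) +P deriv (0# ∷ (as *P q))
      ≈⟨ +P-cong (deriv-scale a q) (deriv-∷ 0# (as *P q)) ⟩
    scale a (deriv q) +P ((as *P q) +P (0# ∷ deriv (as *P q)))
      ≈⟨ +P-cong {p = scale a (deriv q)} ≋-refl (+P-cong {p = as *P q} ≋-refl (∷-cong refl (deriv-* as q))) ⟩
    scale a (deriv q) +P ((as *P q) +P (0# ∷ ((deriv as *P q) +P (as *P deriv q))))
      ≈⟨ +P-cong {p = scale a (deriv q)} ≋-refl (+P-cong {p = as *P q} ≋-refl (∷-cong (sym (+-identityʳ 0#)) ≋-refl)) ⟩
    scale a (deriv q) +P ((as *P q) +P ((0# ∷ (deriv as *P q)) +P (0# ∷ (as *P deriv q))))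
      ≈⟨ PS.solve 4 (λ x y z w → x :+ (y :+ (z :+ w)) := (y :+ z) :+ (x :+ w)) ≋-refl
           (scale a (deriv q)) (as *P q) (0# ∷ (deriv as *P q)) (0# ∷ (as *P deriv q)) ⟩
    ((as *P q) +P (0# ∷ (deriv as *P q))) +P (scale a (deriv q) +P (0# ∷ (as *P deriv q)))
      ≈⟨ P.+-congʳ {(a ∷ as) *P deriv q} (≋-sym (≋-trans (*P-distribʳ q as (0# ∷ deriv as))
           (P.+-congˡ {as *P q} (shift-*P (deriv as) q)))) ⟩
    ((as +P (0# ∷ deriv as)) *P q) +P ((a ∷ as) *P deriv q)
      ≈⟨ P.+-congʳ {(a ∷ as) *P deriv q} (P.*-congʳ {q} (≋-sym (deriv-∷ a as))) ⟩
    (deriv (a ∷ as) *P q) +P ((a ∷ as) *P deriv q) ∎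
    where open ≋-R
          open PS

  -- The integer n + 1 is kept as a constant polynomial factor, so that the whole derivative
  -- vanishes as soon as n + 1 is zero in the ring.
  deriv-^ : ∀ p n → deriv (p ^P suc n) ≋ (const (ntimes (suc n) 1#) *P ((p ^P n) *P deriv p))
  deriv-^ p zero = begin
    deriv (p *P 1P)                      ≈⟨ deriv-* p 1P ⟩
    (deriv p *P 1P) +P (p *P [])         ≈⟨ PS.solve 2 (λ p p' → p' :* :1 :+ p :* :0 := :1 :* (:1 :* p')) ≋-refl p (deriv p) ⟩
    1P *P (1P *P deriv p)                ≈⟨ *P-congʳ 1P (const (1# + 0#)) (1P *P deriv p) (∷-cong (sym (+-identityʳ 1#)) ≋-refl) ⟩
    const (1# + 0#) *P (1P *P deriv p)   ∎
    where open ≋-R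
          open PS
  deriv-^ p (suc n) = begin
    deriv (p *P (p ^P suc n))
      ≈⟨ deriv-* p (p ^P suc n) ⟩
    (deriv p *P (p ^P suc n)) +P (p *P deriv (p ^P suc n))
      ≈⟨ P.+-congˡ {deriv p *P (p ^P suc n)} (P.*-congˡ {p} (deriv-^ p n)) ⟩
    (deriv p *P (p *P (p ^P n))) +P (p *P (const (ntimes (suc n) 1#) *P ((p ^P n) *P deriv p)))
      ≈⟨ PS.solve 4 (λ p p' r k → p' :* (p :* r) :+ p :* (k :* (r :* p')) := (:1 :+ k) :* ((p :* r) :* p')) ≋-refl
           p (deriv p) (p ^P n) (const (ntimes (suc n) 1#)) ⟩
    const (ntimes (suc (suc n)) 1#) *P ((p ^P suc n) *P deriv p) ∎
    where open ≋-R
          open PS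

-- Division by monic polynomials and difference quotients.

module Division {c ℓ} (R : CommutativeRing c ℓ) where
  open CommutativeRing R
  open Poly R
  open PolyTheory R
  open Algebra.Properties.Ring ring using (-0#≈0#)
  private
    module P = CommutativeRing polyRing
    module S = DifferenceSolver R
    module PS = DifferenceSolver polyRing
    module ≈-R = Relation.Binary.Reasoning.Setoid setoid
    module ≋-R = Relation.Binary.Reasoning.Setoid P.setoid

  toList-DegLt : ∀ {d} (v : Vec Carrier d) → DegLt (toList v) d
  toList-DegLt Vec.[]      n       _         = refl
  toList-DegLt (a Vec.∷ v) (suc n) (s≤s d≤n) = toList-DegLt v n d≤n

  monic-leading : ∀ {d} (cs : Vec Carrier d) → coeff (monic cs) d ≈ 1#
  monic-leading Vec.[]       = refl
  monic-leading (_ Vec.∷ cs) = monic-leading cs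

  monic-DegLt : ∀ {d} (cs : Vec Carrier d) → DegLt (monic cs) (suc d)
  monic-DegLt Vec.[]       (suc n) _         = refl
  monic-DegLt (_ Vec.∷ cs) (suc n) (s≤s d≤n) = monic-DegLt cs n d≤n

  DegLt-cong : ∀ {p q d} → p ≋ q → DegLt p d → DegLt q d
  DegLt-cong p≋q p<d n d≤n = trans (sym (at p≋q n)) (p<d n d≤n)

  DegLt-+ : ∀ p q {d} → DegLt p d → DegLt q d → DegLt (p +P q) d
  DegLt-+ p q p<d q<d n d≤n = trans (coeff-+ p q n) (trans (+-cong (p<d n d≤n) (q<d n d≤n)) (+-identityˡ 0#))

  DegLt-neg : ∀ p {d} → DegLt p d → DegLt (-P p) d
  DegLt-neg p p<d n d≤n = trans (coeff-neg p n) (trans (-‿cong (p<d n d≤n)) -0#≈0#)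

  DegLt-0 : ∀ {p} → DegLt p 0 → p ≋ []
  DegLt-0 p<0 = ⟪ (λ n → p<0 n z≤n) ⟫

  DegLt-suc : ∀ {p d} → DegLt p d → DegLt p (suc d)
  DegLt-suc p<d n d<n = p<d n (ℕₚ.<⇒≤ d<n)

  deriv-DegLt : ∀ p {d} → DegLt p (suc d) → DegLt (deriv p) d
  deriv-DegLt p p<d n d≤n = trans (coeff-deriv p n)
    (trans (ntimes-cong (suc n) (p<d (suc n) (s≤s d≤n))) (ntimes-0 (suc n)))

  -- A leading coefficient 1 is not a zero divisor, so this holds over any commutative ring. `k`
  -- only bounds the degree of `h`; both sides may be zero.
  leading-*-monic : ∀ {d} (cs : Vec Carrier d) k h → DegLt h (suc k) →
                    coeff (h *P monic cs) (k ℕ.+ d) ≈ coeff h k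
  leading-*-monic cs k []       h≤k = refl
  leading-*-monic {d} cs zero (a ∷ as) h≤0 = begin
    coeff (scale a (monic cs) +P (0# ∷ (as *P monic cs))) d
      ≈⟨ coeff-+ (scale a (monic cs)) _ d ⟩
    coeff (scale a (monic cs)) d + coeff (0# ∷ (as *P monic cs)) d
      ≈⟨ +-cong (trans (coeff-scale a (monic cs) d) (*-congˡ (monic-leading cs)))
                (at (≋-trans (∷-cong refl (≋[]-*P as (monic cs) (DegLt-0 (λ n _ → h≤0 (suc n) (s≤s z≤n))))) shift-[]) d) ⟩
    a * 1# + 0#
      ≈⟨ trans (+-identityʳ _) (*-identityʳ a) ⟩
    a ∎
    where open ≈-R
  leading-*-monic {d} cs (suc k) (a ∷ as) h≤k = begin
    coeff (scale a (monic cs) +P (0# ∷ (as *P monic cs))) (suc (k ℕ.+ d))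
      ≈⟨ coeff-+ (scale a (monic cs)) _ (suc (k ℕ.+ d)) ⟩
    coeff (scale a (monic cs)) (suc (k ℕ.+ d)) + coeff (as *P monic cs) (k ℕ.+ d)
      ≈⟨ +-cong (trans (coeff-scale a (monic cs) (suc (k ℕ.+ d)))
                       (trans (*-congˡ (monic-DegLt cs (suc (k ℕ.+ d)) (s≤s (ℕₚ.m≤n+m d k)))) (zeroʳ a)))
                (leading-*-monic cs k as (λ n k<n → h≤k (suc n) (s≤s k<n))) ⟩
    0# + coeff as k
      ≈⟨ +-identityˡ _ ⟩
    coeff as k ∎
    where open ≈-R

  -- Above position `d` the head `a` contributes nothing, so the coefficients of the product are
  -- those of the product with the tail, one place lower; induction bounds the tail by `pred k`.
  -- Only for `k = 0` is `a` left over, and then it is the leading coefficient of the product.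
  *-monic-DegLt : ∀ {d} (cs : Vec Carrier d) k h → DegLt (h *P monic cs) (k ℕ.+ d) → DegLt h k
  *-monic-DegLt     cs k []       _     n _ = refl
  *-monic-DegLt {d} cs k (a ∷ as) hm<kd = bound k as<k-1 hm<kd
    where
    tail : ∀ n → d ≤ n → coeff ((a ∷ as) *P monic cs) (suc n) ≈ 0# → coeff (as *P monic cs) n ≈ 0#
    tail n d≤n e = begin
      coeff (as *P monic cs) n
        ≈⟨ sym (+-identityˡ _) ⟩
      0# + coeff (as *P monic cs) n
        ≈⟨ +-congʳ (sym (trans (coeff-scale a (monic cs) (suc n))
             (trans (*-congˡ (monic-DegLt cs (suc n) (s≤s d≤n))) (zeroʳ a)))) ⟩
      coeff (scale a (monic cs)) (suc n) + coeff (as *P monic cs) n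
        ≈⟨ sym (coeff-+ (scale a (monic cs)) _ (suc n)) ⟩
      coeff ((a ∷ as) *P monic cs) (suc n)
        ≈⟨ e ⟩
      0# ∎
      where open ≈-R

    as<k-1 : DegLt as (ℕ.pred k)
    as<k-1 = *-monic-DegLt cs (ℕ.pred k) as
      (λ n le → tail n (ℕₚ.≤-trans (ℕₚ.m≤n+m d (ℕ.pred k)) le)
                  (hm<kd (suc n) (ℕₚ.≤-trans (k≤ k) (s≤s le))))
      where
      k≤ : ∀ k → k ℕ.+ d ≤ suc (ℕ.pred k ℕ.+ d)
      k≤ zero    = ℕₚ.n≤1+n d
      k≤ (suc k) = ℕₚ.≤-refl

    bound : ∀ k → DegLt as (ℕ.pred k) → DegLt ((a ∷ as) *P monic cs) (k ℕ.+ d) → DegLt (a ∷ as) k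
    bound k       as< h< (suc n) k≤n = as< n (ℕₚ.pred-mono-≤ k≤n)
    bound zero    as< h< zero    _   =
      trans (sym (leading-*-monic cs 0 (a ∷ as) λ { (suc n) _ → as< n z≤n })) (h< d ℕₚ.≤-refl)

  -- The leading 1 of the divisor cancels the last entry of `s`, which `divStep` drops by `init`.
  -- `ct` is a variable with an equation so that it stays fixed while the recursion shortens `s`.
  step-remainder : ∀ {d} (cs : Vec Carrier d) (s : Vec Carrier (suc d)) ct → last s ≡ ct →
    toList s ≋ (toList (zipWith (λ si ci → si - ct * ci) (init s) cs) +P scale ct (monic cs))
  step-remainder Vec.[]       (x Vec.∷ Vec.[]) .x ≡.refl = ∷-cong (sym (*-identityʳ x)) ≋-refl
  step-remainder (c Vec.∷ cs) (x Vec.∷ s)      ct eq     =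
    ∷-cong (S.solve 2 (λ x y → x := x :- y :+ y) refl x (ct * c)) (step-remainder cs s ct eq)
    where open S

  rem : ∀ {d} → Vec Carrier d → Pol → Vec Carrier d
  rem cs f = proj₂ (divMod cs f)

  division : ∀ {d} (cs : Vec Carrier d) f → f ≋ ((quot cs f *P monic cs) +P toList (rem cs f))
  division {d} cs [] = ≋-sym (zeros d)
    where
    zeros : ∀ d → toList (Vec.replicate d 0#) ≋ []
    zeros zero    = ≋-refl
    zeros (suc d) = ≋-trans (∷-cong refl (zeros d)) shift-[]
  division cs (a ∷ f) = begin
    a ∷ f
      ≈⟨ ∷-cong (sym (+-identityʳ a)) (≋-trans (division cs f) (P.+-comm (quot cs f *P monic cs) (toList r))) ⟩
    toList (a Vec.∷ r) +P (0# ∷ (quot cs f *P monic cs))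
      ≈⟨ P.+-congʳ (step-remainder cs (a Vec.∷ r) ct ≡.refl) ⟩
    (toList (rem cs (a ∷ f)) +P scale ct (monic cs)) +P (0# ∷ (quot cs f *P monic cs))
      ≈⟨ PS.solve 3 (λ x y z → x :+ y :+ z := y :+ z :+ x) ≋-refl (toList (rem cs (a ∷ f))) _ _ ⟩
    (quot cs (a ∷ f) *P monic cs) +P toList (rem cs (a ∷ f)) ∎
    where
    open ≋-R
    open PS
    r = rem cs f
    ct = last (a Vec.∷ r)

  -- Uniqueness of the quotient: `(g − Q) · monic cs` equals the remainder, hence has degree below
  -- `d`, and `*-monic-DegLt` with bound 0 forces `g − Q` to vanish.
  quot-exact : ∀ {d} (cs : Vec Carrier d) {f} g → f ≋ (monic cs *P g) → quot cs f ≋ g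
  quot-exact {d} cs {f} g f≋mg = begin
    Q              ≈⟨ PS.solve 2 (λ q g → q := g :- (g :- q)) ≋-refl Q g ⟩
    g -P (g -P Q)  ≈⟨ P.+-congˡ {g} (P.-‿cong (DegLt-0 {g -P Q} (*-monic-DegLt cs 0 (g -P Q)
                        (DegLt-cong (≋-sym diff) (toList-DegLt (rem cs f)))))) ⟩
    g -P []        ≈⟨ +P-identityʳ g ⟩
    g              ∎
    where
    open ≋-R
    open PS
    Q = quot cs f
    diff : ((g -P Q) *P monic cs) ≋ toList (rem cs f)
    diff = begin
      (g -P Q) *P monic cs
        ≈⟨ PS.solve 3 (λ g q m → (g :- q) :* m := m :* g :- q :* m) ≋-refl g Q (monic cs) ⟩
      (monic cs *P g) -P (Q *P monic cs)
        ≈⟨ P.+-congʳ (≋-trans (≋-sym f≋mg) (division cs f)) ⟩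
      ((Q *P monic cs) +P toList (rem cs f)) -P (Q *P monic cs)
        ≈⟨ PS.solve 2 (λ x y → x :+ y :- x := y) ≋-refl (Q *P monic cs) (toList (rem cs f)) ⟩
      toList (rem cs f) ∎

  -- Exactness of the division by t - θ is not invoked: the remainder is a constant, so
  -- differentiation removes it together with the subtracted value of `f`.
  deriv-diffQ : ∀ θ f → deriv f ≋ ((deriv (diffQ θ f) *P ((- θ) ∷ 1# ∷ [])) +P diffQ θ f)
  deriv-diffQ θ f = begin
    deriv f
      ≈⟨ ≋-sym (+P-identityʳ (deriv f)) ⟩
    deriv f +P deriv (-P const (eval f θ))
      ≈⟨ ≋-sym (deriv-+ f _) ⟩
    deriv f'
      ≈⟨ deriv-cong (division lin f') ⟩
    deriv ((Q *P monic lin) +P toList (rem lin f'))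
      ≈⟨ deriv-+ (Q *P monic lin) (toList (rem lin f')) ⟩
    deriv (Q *P monic lin) +P deriv (toList (rem lin f'))
      ≈⟨ +P-cong {q' = []} (deriv-* Q (monic lin)) (DegLt-0 (deriv-DegLt (toList (rem lin f')) (toList-DegLt (rem lin f')))) ⟩
    ((deriv Q *P monic lin) +P (Q *P const (1# + 0#))) +P []
      ≈⟨ P.+-congʳ {[]} (P.+-congˡ {deriv Q *P monic lin} (P.*-congˡ {Q} (∷-cong {b = 1#} (+-identityʳ 1#) (≋-refl {[]})))) ⟩
    ((deriv Q *P monic lin) +P (Q *P 1P)) +P []
      ≈⟨ PS.solve 3 (λ q' m q → q' :* m :+ q :* :1 :+ :0 := q' :* m :+ q) ≋-refl (deriv Q) (monic lin) Q ⟩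
    (deriv Q *P monic lin) +P Q ∎
    where
    open ≋-R
    open PS
    lin = (- θ) Vec.∷ Vec.[]
    f' = f -P const (eval f θ)
    Q = diffQ θ f

  private
    lin-root : ∀ θ → eval ((- θ) ∷ 1# ∷ []) θ ≈ 0#
    lin-root θ = S.solve 1 (λ θ → :- θ :+ θ :* (:1 :+ θ :* :0) := :0) refl θ
      where open S

  eval-diffQ : ∀ θ f → eval (diffQ θ f) θ ≈ eval (deriv f) θ
  eval-diffQ θ f = sym (begin
    eval (deriv f) θ
      ≈⟨ eval-cong (deriv f) _ θ (deriv-diffQ θ f) ⟩
    eval ((deriv Q *P lin) +P Q) θ
      ≈⟨ trans (eval-+ (deriv Q *P lin) Q θ) (+-congʳ (eval-* (deriv Q) lin θ)) ⟩
    eval (deriv Q) θ * eval lin θ + eval Q θ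
      ≈⟨ +-congʳ (trans (*-congˡ (lin-root θ)) (zeroʳ _)) ⟩
    0# + eval Q θ
      ≈⟨ +-identityˡ _ ⟩
    eval Q θ ∎)
    where
    open ≈-R
    lin = (- θ) ∷ 1# ∷ []
    Q = diffQ θ f

  -- With u the difference quotient, differentiating f′ = u′ (t - θ) + u gives f″ = u″ (t - θ) +
  -- 2u′, and the first term dies at θ. Since u′(θ) is in turn the value of the next difference
  -- quotient, this is the source of the 2 in condition (iii).
  eval-deriv-diffQ : ∀ θ f → eval (deriv (diffQ θ f)) θ + eval (deriv (diffQ θ f)) θ ≈ eval (deriv (deriv f)) θ
  eval-deriv-diffQ θ f = sym (begin
    eval (deriv (deriv f)) θ
      ≈⟨ eval-cong _ _ θ (≋-trans (deriv-cong (deriv-diffQ θ f)) (≋-trans (deriv-+ (Q' *P lin) Q) (P.+-congʳ (deriv-* Q' lin)))) ⟩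
    eval (((deriv Q' *P lin) +P (Q' *P deriv lin)) +P Q') θ
      ≈⟨ trans (eval-+ ((deriv Q' *P lin) +P (Q' *P deriv lin)) Q' θ)
           (+-congʳ (trans (eval-+ (deriv Q' *P lin) (Q' *P deriv lin) θ)
             (+-cong (eval-* (deriv Q') lin θ) (eval-* Q' (deriv lin) θ)))) ⟩
    eval (deriv Q') θ * eval lin θ + eval Q' θ * (1# + 0# + θ * 0#) + eval Q' θ
      ≈⟨ +-congʳ (+-congʳ (*-congˡ (lin-root θ))) ⟩
    eval (deriv Q') θ * 0# + eval Q' θ * (1# + 0# + θ * 0#) + eval Q' θ
      ≈⟨ S.solve 3 (λ x y t → x :* :0 :+ y :* (:1 :+ :0 :+ t :* :0) :+ y := y :+ y) refl _ _ θ ⟩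
    eval Q' θ + eval Q' θ ∎)
    where
    open ≈-R
    open S
    lin = (- θ) ∷ 1# ∷ []
    Q = diffQ θ f
    Q' = deriv Q

-- Sums and products over lists and their invariance under permutation.

module Fold {a ℓa m ℓm} (A : Setoid a ℓa) (M : CommutativeMonoid m ℓm) where
  open Setoid A using () renaming (Carrier to A₀; _≈_ to _~_; trans to ~-trans; sym to ~-sym)
  open CommutativeMonoid M
  open Algebra.Properties.CommutativeSemigroup commutativeSemigroup using (x∙yz≈y∙xz; interchange)
  open Algebra.Properties.Monoid.Mult monoid public using () renaming (_×_ to _times_)

  fold : (A₀ → Carrier) → List A₀ → Carrier
  fold f = foldr (λ x → f x ∙_) ε

  fold-cong : ∀ {f g xs} → All (λ x → f x ≈ g x) xs → fold f xs ≈ fold g xs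
  fold-cong []       = refl
  fold-cong (e ∷ es) = ∙-cong e (fold-cong es)

  fold-∙ : ∀ f g xs → fold (λ x → f x ∙ g x) xs ≈ fold f xs ∙ fold g xs
  fold-∙ f g []       = sym (identityˡ ε)
  fold-∙ f g (x ∷ xs) = trans (∙-congˡ (fold-∙ f g xs)) (interchange _ _ _ _)

  fold-const : ∀ c xs → fold (λ _ → c) xs ≈ length xs times c
  fold-const c []       = refl
  fold-const c (x ∷ xs) = ∙-congˡ (fold-const c xs)

  fold-map : ∀ f (σ : A₀ → A₀) xs → fold f (map σ xs) ≡ fold (λ x → f (σ x)) xs
  fold-map f σ []       = ≡.refl
  fold-map f σ (x ∷ xs) = ≡.cong (f (σ x) ∙_) (fold-map f σ xs)

  private
    _∈_ : A₀ → List A₀ → Set _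
    x ∈ xs = Any (x ~_) xs

  fold-─ : ∀ {f} → (∀ {x y} → x ~ y → f x ≈ f y) →
           ∀ {x xs} (p : x ∈ xs) → fold f xs ≈ f x ∙ fold f (xs ─ p)
  fold-─ f-cong (here x~y) = ∙-congʳ (sym (f-cong x~y))
  fold-─ f-cong (there p)  = trans (∙-congˡ (fold-─ f-cong p)) (x∙yz≈y∙xz _ _ _)

  ∈-─ : ∀ {x y xs} (p : x ∈ xs) → ¬ (x ~ y) → y ∈ xs → y ∈ (xs ─ p)
  ∈-─ (here x~z) x≁y (here y~z) = ⊥-elim (x≁y (~-trans x~z (~-sym y~z)))
  ∈-─ (here x~z) x≁y (there q)  = q
  ∈-─ (there p)  x≁y (here y~z) = here y~z
  ∈-─ (there p)  x≁y (there q)  = there (∈-─ p x≁y q)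

  -- Counting stands in for surjectivity: each `y` is removed from `xs`, distinctness keeps the
  -- remaining ones inside what is left, and equal lengths leave nothing over.
  fold-⊆ : ∀ {f} → (∀ {x y} → x ~ y → f x ≈ f y) → ∀ xs ys →
           AllPairs (λ x y → ¬ (x ~ y)) ys → All (_∈ xs) ys → length xs ≡ length ys →
           fold f ys ≈ fold f xs
  fold-⊆ f-cong []       []       _            _             _  = refl
  fold-⊆ f-cong xs       (y ∷ ys) (y∉ys ∷ ys!) (y∈xs ∷ ys⊆xs) eq = trans
    (∙-congˡ (fold-⊆ f-cong (xs ─ y∈xs) ys ys! (All.zipWith (λ (y≁z , z∈xs) → ∈-─ y∈xs y≁z z∈xs) (y∉ys , ys⊆xs))
      (ℕₚ.suc-injective (≡.trans (≡.sym (length-removeAt′ xs (index y∈xs))) eq))))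
    (sym (fold-─ f-cong y∈xs))

  fold-permute : ∀ {f} → (∀ {x y} → x ~ y → f x ≈ f y) → (σ : A₀ → A₀) → ∀ xs →
                 All (λ x → σ x ∈ xs) xs → AllPairs (λ x y → ¬ (σ x ~ σ y)) xs →
                 fold (λ x → f (σ x)) xs ≈ fold f xs
  fold-permute {f} f-cong σ xs σ∈xs σ-inj = trans (reflexive (≡.sym (fold-map f σ xs)))
    (fold-⊆ f-cong xs (map σ xs) (AllPairsₚ.map⁺ σ-inj) (Allₚ.map⁺ σ∈xs) (≡.sym (length-map σ xs)))

-- Parity of prime powers.

odd-half : ∀ {n} → ¬ (2 ∣ n) → Σ ℕ λ j → n ≡ suc (j ℕ.* 2)
odd-half {n} 2∤n with n % 2 | m%n<n n 2 | m≡m%n+[m/n]*n n 2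
... | 0 | _ | eq = ⊥-elim (2∤n (divides (n / 2) eq))
... | 1 | _ | eq = n / 2 , eq
... | suc (suc _) | s≤s (s≤s ()) | _

odd-prime-power : ∀ {p} → Prime p → p ≢ 2 → ∀ k → ¬ (2 ∣ p ^ k)
odd-prime-power pp p≢2 zero    2∣1 with ∣1⇒≡1 2∣1
... | ()
odd-prime-power {p} pp p≢2 (suc k) 2∣p*pᵏ with euclidsLemma p (p ^ k) prime[2] 2∣p*pᵏ
... | inj₂ 2∣pᵏ = odd-prime-power pp p≢2 k 2∣pᵏ
... | inj₁ 2∣p  with prime⇒irreducible pp 2∣p
...   | inj₁ ()
...   | inj₂ 2≡p = p≢2 (≡.sym 2≡p)

-- Finite fields: inverses, characteristic, splitting by roots.

module FieldTheory {c ℓ} (K : FiniteField c ℓ) where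
  open FiniteField K hiding (ring)
  open CommutativeRing (FiniteField.ring K)
  open Poly (FiniteField.ring K)
  open PolyTheory (FiniteField.ring K)
  open Division (FiniteField.ring K)
  open Algebra.Properties.Ring ring using (+-cancelʳ; +-cancelˡ)
  open Algebra.Properties.Semiring.Exp semiring using () renaming (_^_ to _**_)
  private
    module S = DifferenceSolver (FiniteField.ring K)
    module ≈-R = Relation.Binary.Reasoning.Setoid setoid
    module Add = Fold setoid +-commutativeMonoid

  x-y≈0⇒x≈y : ∀ {x y} → x - y ≈ 0# → x ≈ y
  x-y≈0⇒x≈y {x} {y} e = trans (S.solve 2 (λ x y → x := x :- y :+ y) refl x y) (trans (+-congʳ e) (+-identityˡ y))
    where open S

  -- Totalised by sending 0 to 0, so that 1/a(θ) can be written under a sum without carrying a proof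
  -- that a(θ) is nonzero.
  inv : Carrier → Carrier
  inv x with x ≟ 0#
  ... | yes _  = 0#
  ... | no x≉0 = proj₁ (inverse x x≉0)

  *-inv : ∀ {x} → ¬ (x ≈ 0#) → x * inv x ≈ 1#
  *-inv {x} x≉0 with x ≟ 0#
  ... | yes x≈0 = ⊥-elim (x≉0 x≈0)
  ... | no x≉0' = proj₂ (inverse x x≉0')

  inv-0 : ∀ {x} → x ≈ 0# → inv x ≈ 0#
  inv-0 {x} x≈0 with x ≟ 0#
  ... | yes _  = refl
  ... | no x≉0 = ⊥-elim (x≉0 x≈0)

  *-cancelˡ : ∀ {x y z} → ¬ (x ≈ 0#) → x * y ≈ x * z → y ≈ z
  *-cancelˡ {x} {y} {z} x≉0 e = begin
    y              ≈⟨ sym (*-identityˡ y) ⟩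
    1# * y         ≈⟨ *-congʳ (sym (trans (*-comm _ _) (*-inv x≉0))) ⟩
    inv x * x * y  ≈⟨ trans (*-assoc _ _ _) (trans (*-congˡ e) (sym (*-assoc _ _ _))) ⟩
    inv x * x * z  ≈⟨ *-congʳ (trans (*-comm _ _) (*-inv x≉0)) ⟩
    1# * z         ≈⟨ *-identityˡ z ⟩
    z              ∎
    where open ≈-R

  *-≈0 : ∀ {x y} → ¬ (x ≈ 0#) → x * y ≈ 0# → y ≈ 0#
  *-≈0 x≉0 e = *-cancelˡ x≉0 (trans e (sym (zeroʳ _)))

  *-≉0 : ∀ {x y} → ¬ (x ≈ 0#) → ¬ (y ≈ 0#) → ¬ (x * y ≈ 0#)
  *-≉0 x≉0 y≉0 e = y≉0 (*-≈0 x≉0 e)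

  inv-unique : ∀ {x y} → x * y ≈ 1# → y ≈ inv x
  inv-unique {x} {y} e = *-cancelˡ x≉0 (trans e (sym (*-inv x≉0)))
    where
    x≉0 : ¬ (x ≈ 0#)
    x≉0 x≈0 = 0≉1 (trans (sym (zeroˡ y)) (trans (*-congʳ (sym x≈0)) e))

  -- The field `inverse` is not assumed to respect `_≈_`; uniqueness of inverses provides it.
  inv-cong : ∀ {x y} → x ≈ y → inv x ≈ inv y
  inv-cong {x} {y} x≈y with y ≟ 0#
  ... | yes y≈0 = inv-0 (trans x≈y y≈0)
  ... | no y≉0  = sym (inv-unique (trans (*-congʳ x≈y) (proj₂ (inverse y y≉0))))

  inv-*-cancel : ∀ {x y} → ¬ (x ≈ 0#) → ¬ (y ≈ 0#) → x * inv (x * y) ≈ inv y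
  inv-*-cancel {x} {y} x≉0 y≉0 = inv-unique (trans
    (S.solve 3 (λ x y z → y :* (x :* z) := x :* y :* z) refl x y _) (*-inv (*-≉0 x≉0 y≉0)))
    where open S

  -- Translation by 1 permutes the field, so the sum of all elements is unchanged although it gains
  -- `card` copies of 1.
  card·1≈0 : ntimes card 1# ≈ 0#
  card·1≈0 = +-cancelʳ (Add.fold (λ x → x) elements) (ntimes card 1#) 0# (begin
    ntimes card 1# + Add.fold (λ x → x) elements
      ≈⟨ +-congʳ (sym (trans (Add.fold-const 1# elements) (×≈ntimes card 1#))) ⟩
    Add.fold (λ _ → 1#) elements + Add.fold (λ x → x) elements
      ≈⟨ sym (Add.fold-∙ (λ _ → 1#) (λ x → x) elements) ⟩
    Add.fold (λ x → 1# + x) elements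
      ≈⟨ Add.fold-permute (λ e → e) (1# +_) elements (All.tabulate (λ {x} _ → complete (1# + x)))
           (AllPairs.map (λ x≉y e → x≉y (+-cancelˡ 1# _ _ e)) distinct) ⟩
    Add.fold (λ x → x) elements
      ≈⟨ sym (+-identityˡ _) ⟩
    0# + Add.fold (λ x → x) elements ∎)
    where
    open ≈-R

  card^·1≈0 : ∀ {n} → 0 < n → ntimes (card ^ n) 1# ≈ 0#
  card^·1≈0 {suc n} _ = trans (ntimes-1-* card (card ^ n)) (trans (*-congʳ card·1≈0) (zeroˡ _))

  -- With card = 1 + 2j, the equation 1 + 1 = 0 would give card · 1 = 1, whereas card · 1 = 0.
  1+1≉0 : ¬ (2 ∣ card) → ¬ (1# + 1# ≈ 0#)
  1+1≉0 2∤card 1+1≈0 with odd-half 2∤card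
  ... | j , card≡1+2j = 0≉1 (begin
    0#                                  ≈⟨ sym card·1≈0 ⟩
    ntimes card 1#                      ≡⟨ ≡.cong (λ n → ntimes n 1#) card≡1+2j ⟩
    1# + ntimes (j ℕ.* 2) 1#            ≈⟨ +-congˡ (ntimes-1-* j 2) ⟩
    1# + ntimes j 1# * (1# + (1# + 0#)) ≈⟨ +-congˡ (*-congˡ (trans (+-congˡ (+-identityʳ 1#)) 1+1≈0)) ⟩
    1# + ntimes j 1# * 0#               ≈⟨ trans (+-congˡ (zeroʳ _)) (+-identityʳ 1#) ⟩
    1#                                  ∎)
    where open ≈-R

  -- Lists may end in zeros, so the true degree is found by testing coefficients from the top. A
  -- unit times a monic vector is the form to which division applies.
  normalise : ∀ f → f ≋ [] ⊎
    Σ ℕ λ m → Σ (Vec Carrier m) λ v → Σ Carrier λ u → ¬ (u ≈ 0#) × f ≋ scale u (monic v)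
  normalise [] = inj₁ ≋-refl
  normalise (a ∷ as) with normalise as
  ... | inj₂ (m , v , u , u≉0 , e) = inj₂ (suc m , (inv u * a) Vec.∷ v , u , u≉0 , ∷-cong
          (sym (trans (sym (*-assoc _ _ _)) (trans (*-congʳ (*-inv u≉0)) (*-identityˡ a)))) e)
  ... | inj₁ e with a ≟ 0#
  ...   | yes a≈0 = inj₁ (≋-trans (∷-cong a≈0 e) shift-[])
  ...   | no a≉0  = inj₂ (0 , Vec.[] , a , a≉0 , ∷-cong (sym (*-identityʳ a)) e)

  scale-monic-DegLt : ∀ {m n u} (v : Vec Carrier m) → ¬ (u ≈ 0#) → DegLt (scale u (monic v)) n → m < n
  scale-monic-DegLt {m} {n} {u} v u≉0 deg = ℕₚ.≰⇒> (λ n≤m → u≉0 (begin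
    u                           ≈⟨ sym (*-identityʳ u) ⟩
    u * 1#                      ≈⟨ *-congˡ (sym (monic-leading v)) ⟩
    u * coeff (monic v) m       ≈⟨ sym (coeff-scale u (monic v) m) ⟩
    coeff (scale u (monic v)) m ≈⟨ deg m n≤m ⟩
    0#                          ∎))
    where open ≈-R

  -- Horner's scheme: the coefficients of the quotient by x - r are the values at r of the
  -- successive tails.
  divide-root : ∀ {n} → Vec Carrier (suc n) → Carrier → Vec Carrier n
  divide-root (a Vec.∷ Vec.[])        r = Vec.[]
  divide-root (a Vec.∷ v@(_ Vec.∷ _)) r = eval (monic v) r Vec.∷ divide-root v r

  divide-root-correct : ∀ {n} (v : Vec Carrier (suc n)) r x →
    eval (monic v) x ≈ eval (monic v) r + (x - r) * eval (monic (divide-root v r)) x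
  divide-root-correct (a Vec.∷ Vec.[]) r x =
    S.solve 3 (λ a r x → a :+ x :* (:1 :+ x :* :0) := a :+ r :* (:1 :+ r :* :0) :+ (x :- r) :* (:1 :+ x :* :0)) refl a r x
    where open S
  divide-root-correct (a Vec.∷ v@(_ Vec.∷ _)) r x = trans (+-congˡ (*-congˡ (divide-root-correct v r x)))
    (S.solve 5 (λ a r x y z → a :+ x :* (y :+ (x :- r) :* z) := a :+ r :* y :+ (x :- r) :* (y :+ x :* z))
      refl a r x (eval (monic v) r) (eval (monic (divide-root v r)) x))
    where open S

  product : List Carrier → Carrier
  product = foldr _*_ 1#

  -- After division by x - r every other root s stays a root of the quotient, because s - r is
  -- nonzero and cancels. Stated on values, which is what evaluation at 0 in `wilson` asks for.
  monic-split : ∀ {n} (v : Vec Carrier n) rs → length rs ≡ n → AllPairs (λ x y → ¬ (x ≈ y)) rs →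
    All (λ r → eval (monic v) r ≈ 0#) rs → ∀ x → eval (monic v) x ≈ product (map (λ r → x - r) rs)
  monic-split Vec.[] [] ≡.refl _ _ x = trans (+-congˡ (zeroʳ x)) (+-identityʳ 1#)
  monic-split v (r ∷ rs) ≡.refl (r∉rs ∷ rs!) (vr≈0 ∷ roots) x = begin
    eval (monic v) x                                  ≈⟨ factor x ⟩
    (x - r) * eval (monic w) x                        ≈⟨ *-congˡ (monic-split w rs ≡.refl rs!
        (All.zipWith (λ {s} (r≉s , vs≈0) → *-≈0 (λ e → r≉s (sym (x-y≈0⇒x≈y e))) (trans (sym (factor s)) vs≈0))
                     (r∉rs , roots)) x) ⟩
    (x - r) * product (map (λ r → x - r) rs)          ∎
    where
    open ≈-R
    w = divide-root v r
    factor : ∀ x → eval (monic v) x ≈ (x - r) * eval (monic w) x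
    factor x = trans (divide-root-correct v r x) (trans (+-congʳ vr≈0) (+-identityˡ _))

  monic-X^ : ∀ n x → eval (monic (Vec.replicate n 0#)) x ≈ x ** n
  monic-X^ zero    x = trans (+-congˡ (zeroʳ x)) (+-identityʳ 1#)
  monic-X^ (suc n) x = trans (+-identityˡ _) (*-congˡ (monic-X^ n x))

-- Transport of polynomials along a ring homomorphism.

module BaseChange {c ℓ c' ℓ'} (R : CommutativeRing c ℓ) (S : CommutativeRing c' ℓ')
  (ι : CommutativeRing.Carrier R → CommutativeRing.Carrier S)
  (hom : RingMorphisms.IsRingHomomorphism (CommutativeRing.rawRing R) (CommutativeRing.rawRing S) ι) where

  open RingMorphisms.IsRingHomomorphism hom
  private
    module R = CommutativeRing R
    module A = Poly R
    module AT = PolyTheory R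
    module B = Poly S
  open CommutativeRing S
  open PolyTheory S
  private
    module P = CommutativeRing polyRing

  coeff-map : ∀ p n → B.coeff (map ι p) n ≈ ι (A.coeff p n)
  coeff-map []       n       = sym 0#-homo
  coeff-map (a ∷ as) zero    = refl
  coeff-map (a ∷ as) (suc n) = coeff-map as n

  map-cong : ∀ {p q} → p AT.≋ q → map ι p ≋ map ι q
  map-cong {p} {q} e = ⟪ (λ n → trans (coeff-map p n) (trans (⟦⟧-cong (AT.at e n)) (sym (coeff-map q n)))) ⟫

  map-+ : ∀ p q → map ι (p A.+P q) ≋ (map ι p B.+P map ι q)
  map-+ []       q        = ≋-refl
  map-+ (a ∷ as) []       = ≋-refl
  map-+ (a ∷ as) (b ∷ bs) = ∷-cong (+-homo a b) (map-+ as bs)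

  map-neg : ∀ p → map ι (A.-P p) ≋ (B.-P map ι p)
  map-neg []       = ≋-refl
  map-neg (a ∷ as) = ∷-cong (-‿homo a) (map-neg as)

  map-scale : ∀ a p → map ι (A.scale a p) ≋ B.scale (ι a) (map ι p)
  map-scale a []       = ≋-refl
  map-scale a (b ∷ bs) = ∷-cong (*-homo a b) (map-scale a bs)

  map-* : ∀ p q → map ι (p A.*P q) ≋ (map ι p B.*P map ι q)
  map-* []       q = ≋-refl
  map-* (a ∷ as) q = ≋-trans (map-+ (A.scale a q) _) (+P-cong (map-scale a q) (∷-cong 0#-homo (map-* as q)))

  map-1P : map ι A.1P ≋ B.1P
  map-1P = ∷-cong 1#-homo ≋-refl

  map-^ : ∀ p n → map ι (p A.^P n) ≋ (map ι p B.^P n)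
  map-^ p zero    = map-1P
  map-^ p (suc n) = ≋-trans (map-* p (p A.^P n)) (P.*-congˡ {map ι p} (map-^ p n))

  ι-ntimes : ∀ n x → ι (A.ntimes n x) ≈ B.ntimes n (ι x)
  ι-ntimes zero    x = 0#-homo
  ι-ntimes (suc n) x = trans (+-homo x _) (+-congˡ (ι-ntimes n x))

  map-deriv : ∀ p → map ι (A.deriv p) ≋ B.deriv (map ι p)
  map-deriv p = ⟪ (λ n → trans (coeff-map (A.deriv p) n) (trans (⟦⟧-cong (AT.coeff-deriv p n))
    (trans (ι-ntimes (suc n) (A.coeff p (suc n))) (trans (ntimes-cong (suc n) (sym (coeff-map p (suc n))))
      (sym (coeff-deriv (map ι p) n)))))) ⟫

  map-monic : ∀ {d} (cs : Vec R.Carrier d) → map ι (A.monic cs) ≋ B.monic (Vec.map ι cs)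
  map-monic Vec.[]       = map-1P
  map-monic (c Vec.∷ cs) = ∷-cong refl (map-monic cs)

-- Auxiliary facts on lists without repetition.

AllPairs-refine : ∀ {a p r s} {A : Set a} {P : A → Set p} {R : A → A → Set r} {S : A → A → Set s} {xs} →
  (∀ {x y} → P x → P y → R x y → S x y) → All P xs → AllPairs R xs → AllPairs S xs
AllPairs-refine f []         []         = []
AllPairs-refine f (px ∷ pxs) (rx ∷ rxs) =
  All.zipWith (λ (py , rxy) → f px py rxy) (pxs , rx) ∷ AllPairs-refine f pxs rxs

-- Used with `Z` meaning "is the zero polynomial": zero is listed exactly once, so q^d - 1
-- polynomials survive the filter.
length-filter-unique : ∀ {a r z} {A : Set a} {_~_ : A → A → Set r} {Z : A → Set z} (Z? : ∀ x → Dec (Z x)) →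
  (∀ {x y} → Z x → Z y → x ~ y) → ∀ xs → AllPairs (λ x y → ¬ (x ~ y)) xs → Any Z xs →
  suc (length (filter (λ x → ¬? (Z? x)) xs)) ≡ length xs
length-filter-unique Z? Z⇒~ (x ∷ xs) (x∉xs ∷ xs!) z with Z? x
... | yes zx = ≡.cong (λ ys → suc (length ys))
                 (filter-all (λ x → ¬? (Z? x)) (All.map (λ x≁y zy → x≁y (Z⇒~ zx zy)) x∉xs))
... | no ¬zx = ≡.cong suc (length-filter-unique Z? Z⇒~ xs xs! (Any.tail ¬zx z))

-- The values at θ of polynomials over `K`.

module Root {c ℓ c' ℓ'} (K : FiniteField c ℓ) (L : FiniteField c' ℓ')
  (ι : CommutativeRing.Carrier (FiniteField.ring K) → CommutativeRing.Carrier (FiniteField.ring L))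
  (hom : IsFieldEmbedding K L ι)
  {d : ℕ} (cs : Vec (CommutativeRing.Carrier (FiniteField.ring K)) d)
  (irr : Poly.Irreducible (FiniteField.ring K) (Poly.monic (FiniteField.ring K) cs))
  (θ : CommutativeRing.Carrier (FiniteField.ring L))
  (root : CommutativeRing._≈_ (FiniteField.ring L) (Poly.eval (FiniteField.ring L) (Wilson.℘L K L ι cs θ) θ)
            (CommutativeRing.0# (FiniteField.ring L)))
  where

  open CommutativeRing (FiniteField.ring L)
  open RingMorphisms.IsRingHomomorphism hom using (+-homo; 0#-homo; 1#-homo; ⟦⟧-cong; *-homo)
  open Wilson K L ι cs θ using (q; ℘; allPolys; isZeroList?)
  open BaseChange (FiniteField.ring K) (FiniteField.ring L) ι hom
  open Poly (FiniteField.ring K)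
  open PolyTheory (FiniteField.ring K)
  open Division (FiniteField.ring K)
  open FieldTheory L using (inv; *-inv; *-cancelˡ; *-≈0; *-≉0; inv-cong; inv-*-cancel; x-y≈0⇒x≈y; product; monic-split; monic-X^)
  open FiniteField L using (0≉1; _≟_)
  open Algebra.Properties.Semiring.Exp semiring using () renaming (_^_ to _**_)
  private
    module RK = CommutativeRing (FiniteField.ring K)
    module FK = FiniteField K
    module KT = FieldTheory K
    module B = Poly (FiniteField.ring L)
    module BT = PolyTheory (FiniteField.ring L)
    module P = CommutativeRing polyRing
    module S = DifferenceSolver (FiniteField.ring L)
    module PS = DifferenceSolver polyRing
    module ≈-R = Relation.Binary.Reasoning.Setoid setoid
    module ≋-R = Relation.Binary.Reasoning.Setoid P.setoid

  ev : Pol → Carrier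
  ev f = B.eval (map ι f) θ

  ev-cong : ∀ {f g} → f ≋ g → ev f ≈ ev g
  ev-cong {f} {g} e = BT.eval-cong (map ι f) (map ι g) θ (map-cong e)

  ev-+ : ∀ f g → ev (f +P g) ≈ ev f + ev g
  ev-+ f g = trans (BT.eval-cong _ _ θ (map-+ f g)) (BT.eval-+ (map ι f) (map ι g) θ)

  ev-* : ∀ f g → ev (f *P g) ≈ ev f * ev g
  ev-* f g = trans (BT.eval-cong _ _ θ (map-* f g)) (BT.eval-* (map ι f) (map ι g) θ)

  ev-neg : ∀ f → ev (-P f) ≈ - ev f
  ev-neg f = trans (BT.eval-cong _ _ θ (map-neg f)) (BT.eval-neg (map ι f) θ)

  ev-1P : ev 1P ≈ 1#
  ev-1P = trans (BT.eval-cong (map ι 1P) B.1P θ map-1P) (BT.eval-const 1# θ)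

  ev-^ : ∀ f n → ev (f ^P n) ≈ ev f ** n
  ev-^ f zero    = ev-1P
  ev-^ f (suc n) = trans (ev-* f (f ^P n)) (*-congˡ (ev-^ f n))

  ev-scale : ∀ u f → ev (scale u f) ≈ ι u * ev f
  ev-scale u f = trans (BT.eval-cong _ _ θ (map-scale u f)) (BT.eval-scale (ι u) (map ι f) θ)

  -- Irreducibility and vanishing at θ.

  1≉0 : ¬ (1# ≈ 0#)
  1≉0 e = 0≉1 (sym e)

  ι-≉0 : ∀ {u} → ¬ (u RK.≈ RK.0#) → ¬ (ι u ≈ 0#)
  ι-≉0 {u} u≉0 e with FK.inverse u u≉0
  ... | v , uv≈1 = 1≉0 (trans (sym 1#-homo) (trans (sym (⟦⟧-cong uv≈1)) (trans (*-homo u v) (trans (*-congʳ e) (zeroˡ _)))))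

  -- Dividing ℘ by a monic v of smaller degree vanishing at θ leaves a remainder vanishing at θ,
  -- which is zero by induction; so v would be a proper factor of ℘.
  no-monic-root : ∀ b {n} → n < b → n < d → (v : Vec RK.Carrier n) → ¬ (ev (monic v) ≈ 0#)
  no-monic-root (suc b) {n} (s≤s n≤b) n<d v ev≈0 with KT.normalise r
    where r = toList (rem v ℘)
  ... | inj₂ (m , w , u , u≉0 , r≋uw) = no-monic-root b (ℕₚ.<-≤-trans m<n n≤b) (ℕₚ.<-trans m<n n<d) w
          (*-≈0 (ι-≉0 u≉0) (trans (sym (ev-scale u (monic w))) (trans (sym (ev-cong r≋uw)) ev-r)))
    where
    m<n = KT.scale-monic-DegLt w u≉0 (DegLt-cong r≋uw (toList-DegLt (rem v ℘)))
    ev-r : ev (toList (rem v ℘)) ≈ 0#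
    ev-r = begin
      ev (toList (rem v ℘))
        ≈⟨ sym (+-identityˡ _) ⟩
      0# + ev (toList (rem v ℘))
        ≈⟨ +-congʳ (sym (trans (ev-* (quot v ℘) (monic v)) (trans (*-congˡ ev≈0) (zeroʳ _)))) ⟩
      ev (quot v ℘ *P monic v) + ev (toList (rem v ℘))
        ≈⟨ sym (trans (ev-cong (division v ℘)) (ev-+ (quot v ℘ *P monic v) (toList (rem v ℘)))) ⟩
      ev ℘
        ≈⟨ root ⟩
      0# ∎
      where open ≈-R
  ... | inj₁ r≋[] with proj₂ irr (monic v) (quot v ℘) (at (≋-trans ℘≋Qv (P.*-comm (quot v ℘) (monic v))))
    where
    ℘≋Qv : ℘ ≋ (quot v ℘ *P monic v)
    ℘≋Qv = ≋-trans (division v ℘) (≋-trans (P.+-congˡ {quot v ℘ *P monic v} r≋[]) (+P-identityʳ _))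
  ...   | inj₁ v<1 = constant v v<1 ev≈0
    where
    constant : ∀ {n} (v : Vec RK.Carrier n) → DegLt (monic v) 1 → ev (monic v) ≈ 0# → ⊥
    constant {zero}  Vec.[] _   ev≈0 = 1≉0 (trans (sym ev-1P) ev≈0)
    constant {suc n} v      v<1 _    = FK.0≉1 (RK.trans (RK.sym (v<1 (suc n) (s≤s z≤n))) (monic-leading v))
  -- A constant cofactor is impossible too: `v` has degree n < d, and the coefficient of `Q` at d -
  -- n ≥ 1 is the leading coefficient 1 of `℘`.
  ...   | inj₂ Q<1 = FK.0≉1 (begin
      RK.0#                                  ≈⟨ RK.sym (Q<1 k 1≤k) ⟩
      coeff Q k                              ≈⟨ RK.sym (leading-*-monic v k Q (λ m k<m → Q<1 m (ℕₚ.≤-trans (s≤s z≤n) k<m))) ⟩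
      coeff (Q *P monic v) (k ℕ.+ n)         ≈⟨ RK.reflexive (≡.cong (coeff (Q *P monic v)) (ℕₚ.m∸n+n≡m (ℕₚ.<⇒≤ n<d))) ⟩
      coeff (Q *P monic v) d                 ≈⟨ RK.sym (at (≋-trans (division v ℘) (≋-trans (P.+-congˡ {Q *P monic v} r≋[]) (+P-identityʳ _))) d) ⟩
      coeff ℘ d                              ≈⟨ monic-leading cs ⟩
      RK.1#                                  ∎)
    where
    open Relation.Binary.Reasoning.Setoid RK.setoid
    Q = quot v ℘
    k = d ℕ.∸ n
    1≤k : 1 ≤ k
    1≤k = ℕₚ.m<n⇒0<n∸m n<d

  -- In effect `℘` is the minimal polynomial of `θ`; normalising `f` reduces the claim to monic
  -- polynomials.
  low-degree-root : ∀ f → DegLt f d → ev f ≈ 0# → f ≋ []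
  low-degree-root f f<d ev≈0 with KT.normalise f
  ... | inj₁ e = e
  ... | inj₂ (m , v , u , u≉0 , e) = ⊥-elim (no-monic-root (suc m) ℕₚ.≤-refl
          (KT.scale-monic-DegLt v u≉0 (DegLt-cong e f<d)) v
          (*-≈0 (ι-≉0 u≉0) (trans (sym (ev-scale u (monic v))) (trans (sym (ev-cong e)) ev≈0))))

  ev-rem : ∀ f → ev (toList (rem cs f)) ≈ ev f
  ev-rem f = sym (begin
    ev f                                              ≈⟨ ev-cong (division cs f) ⟩
    ev ((quot cs f *P ℘) +P toList (rem cs f))        ≈⟨ ev-+ (quot cs f *P ℘) (toList (rem cs f)) ⟩
    ev (quot cs f *P ℘) + ev (toList (rem cs f))      ≈⟨ +-congʳ (trans (ev-* (quot cs f) ℘) (trans (*-congˡ root) (zeroʳ _))) ⟩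
    0# + ev (toList (rem cs f))                       ≈⟨ +-identityˡ _ ⟩
    ev (toList (rem cs f))                            ∎)
    where open ≈-R

  root⇒divisible : ∀ f → ev f ≈ 0# → f ≋ (℘ *P quot cs f)
  root⇒divisible f ev≈0 = begin
    f                                          ≈⟨ division cs f ⟩
    (quot cs f *P ℘) +P toList (rem cs f)      ≈⟨ P.+-congˡ {quot cs f *P ℘}
        (low-degree-root _ (toList-DegLt (rem cs f)) (trans (ev-rem f) ev≈0)) ⟩
    (quot cs f *P ℘) +P []                     ≈⟨ PS.solve 2 (λ x y → x :* y :+ :0 := y :* x) ≋-refl (quot cs f) ℘ ⟩
    ℘ *P quot cs f                             ∎
    where open ≋-R
          open PS

  -- The list of nonzero residues modulo ℘.

  All-zero⇒≋[] : ∀ {p} → All (RK._≈ RK.0#) p → p ≋ []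
  All-zero⇒≋[] []       = ≋-refl
  All-zero⇒≋[] (e ∷ es) = ≋-trans (∷-cong e (All-zero⇒≋[] es)) shift-[]

  ≋[]⇒All-zero : ∀ p → p ≋ [] → All (RK._≈ RK.0#) p
  ≋[]⇒All-zero []       e = []
  ≋[]⇒All-zero (a ∷ as) e = at e 0 ∷ ≋[]⇒All-zero as (∷-tail-[] e)

  length-allPolys : ∀ n → length (allPolys n) ≡ q ^ n
  length-allPolys zero    = ≡.refl
  length-allPolys (suc n) = ≡.trans (length-concatMap FK.elements) (≡.cong (q ℕ.*_) (length-allPolys n))
    where
    length-concatMap : ∀ xs → length (concatMap (λ a → map (a ∷_) (allPolys n)) xs) ≡ length xs ℕ.* length (allPolys n)
    length-concatMap []       = ≡.refl
    length-concatMap (x ∷ xs) = ≡.trans (length-++ (map (x ∷_) (allPolys n)))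
      (≡.cong₂ ℕ._+_ (length-map (x ∷_) (allPolys n)) (length-concatMap xs))

  allPolys-DegLt : ∀ n → All (λ p → DegLt p n) (allPolys n)
  allPolys-DegLt zero    = (λ _ _ → RK.refl) ∷ []
  allPolys-DegLt (suc n) = Allₚ.concat⁺ (Allₚ.map⁺ (All.universal (λ a → Allₚ.map⁺
    (All.map (λ { p<n (suc m) (s≤s n≤m) → p<n m n≤m }) (allPolys-DegLt n))) FK.elements))

  allPolys-unique : ∀ n → AllPairs (λ f g → ¬ (f ≋ g)) (allPolys n)
  allPolys-unique zero    = [] ∷ []
  allPolys-unique (suc n) = AllPairsₚ.concat⁺
    (Allₚ.map⁺ (All.universal (λ a → AllPairsₚ.map⁺ (AllPairs.map (λ f≄g e → f≄g (∷-tail e)) (allPolys-unique n))) FK.elements))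
    (AllPairsₚ.map⁺ (AllPairs.map
      (λ a≉b → Allₚ.map⁺ (All.universal (λ f → Allₚ.map⁺ (All.universal (λ g e → a≉b (at e 0)) (allPolys n))) (allPolys n)))
      FK.distinct))

  allPolys-complete : ∀ n f → DegLt f n → Any (f ≋_) (allPolys n)
  allPolys-complete zero    f        f<0 = here (DegLt-0 f<0)
  -- Every list in `allPolys (suc n)` has length exactly n + 1, so the empty list must be matched by
  -- one that starts with zero.
  allPolys-complete (suc n) []       f<n = cons RK.0# [] (≋-sym shift-[]) (λ _ _ → RK.refl)
    where
    cons : ∀ {f} a as → f ≋ (a ∷ as) → DegLt as n → Any (f ≋_) (allPolys (suc n))
    cons a as e as<n = Anyₚ.concatMap⁺ (λ a → map (a ∷_) (allPolys n)) (Any.map (λ a≈b →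
      Anyₚ.map⁺ (Any.map (λ as≋bs → ≋-trans e (∷-cong a≈b as≋bs)) (allPolys-complete n as as<n))) (FK.complete a))
  allPolys-complete (suc n) (a ∷ as) f<n = Anyₚ.concatMap⁺ (λ a → map (a ∷_) (allPolys n)) (Any.map (λ a≈b →
      Anyₚ.map⁺ (Any.map (λ as≋bs → ∷-cong a≈b as≋bs) (allPolys-complete n as (λ m n≤m → f<n (suc m) (s≤s n≤m))))) (FK.complete a))

  nonzeroPolys : List Pol
  nonzeroPolys = filter (λ p → ¬? (isZeroList? p)) (allPolys d)

  nonzeroPolys-DegLt : All (λ p → DegLt p d) nonzeroPolys
  nonzeroPolys-DegLt = Allₚ.filter⁺ (λ p → ¬? (isZeroList? p)) (allPolys-DegLt d)

  nonzeroPolys-ev≉0 : All (λ p → ¬ (ev p ≈ 0#)) nonzeroPolys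
  nonzeroPolys-ev≉0 = All.zipWith (λ {p} (p≉0 , p<d) e → p≉0 (≋[]⇒All-zero p (low-degree-root p p<d e)))
    (Allₚ.all-filter (λ p → ¬? (isZeroList? p)) (allPolys d) , nonzeroPolys-DegLt)

  nonzeroPolys-unique : AllPairs (λ f g → ¬ (f ≋ g)) nonzeroPolys
  nonzeroPolys-unique = AllPairsₚ.filter⁺ (λ p → ¬? (isZeroList? p)) (allPolys-unique d)

  nonzeroPolys-complete : ∀ f → DegLt f d → ¬ (f ≋ []) → Any (f ≋_) nonzeroPolys
  nonzeroPolys-complete f f<d f≄[] with Anyₚ.filter⁺ (λ p → ¬? (isZeroList? p)) (allPolys-complete d f f<d)
  ... | inj₁ p  = p
  ... | inj₂ ¬¬zero = ⊥-elim (¬¬zero (λ zero → f≄[] (≋-trans (Anyₚ.lookup-result (allPolys-complete d f f<d)) (All-zero⇒≋[] zero))))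

  length-nonzeroPolys : suc (length nonzeroPolys) ≡ q ^ d
  length-nonzeroPolys = ≡.trans
    (length-filter-unique isZeroList? (λ zx zy → ≋-trans (All-zero⇒≋[] zx) (≋-sym (All-zero⇒≋[] zy)))
      (allPolys d) (allPolys-unique d)
      (Any.map (λ {p} e → ≋[]⇒All-zero p (≋-sym e)) (allPolys-complete d [] (λ _ _ → RK.refl))))
    (length-allPolys d)

  ev-injective : ∀ f g → DegLt f d → DegLt g d → ev f ≈ ev g → f ≋ g
  ev-injective f g f<d g<d e = begin
    f               ≈⟨ PS.solve 2 (λ f g → f := (f :- g) :+ g) ≋-refl f g ⟩
    (f -P g) +P g   ≈⟨ P.+-congʳ {g} (low-degree-root (f -P g) (DegLt-+ f (-P g) f<d (DegLt-neg g g<d))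
        (trans (ev-+ f (-P g)) (trans (+-cong e (ev-neg g)) (-‿inverseʳ _)))) ⟩
    g               ∎
    where open ≋-R
          open PS

  -- Multiplication by a unit permutes the residues.

  reduce : Pol → Pol → Pol
  reduce g a = toList (rem cs (g *P a))

  ev-reduce : ∀ g a → ev (reduce g a) ≈ ev g * ev a
  ev-reduce g a = trans (ev-rem (g *P a)) (ev-* g a)

  module Permutation (g : Pol) (ev≉0 : ¬ (ev g ≈ 0#)) where

    reduce-∈ : All (λ a → Any (reduce g a ≋_) nonzeroPolys) nonzeroPolys
    reduce-∈ = All.map (λ {a} a≉0 → nonzeroPolys-complete (reduce g a) (toList-DegLt (rem cs (g *P a)))
      (λ e → *-≉0 ev≉0 a≉0 (trans (sym (ev-reduce g a)) (ev-cong e)))) nonzeroPolys-ev≉0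

    reduce-injective : AllPairs (λ a b → ¬ (reduce g a ≋ reduce g b)) nonzeroPolys
    reduce-injective = AllPairs-refine (λ {a} {b} a<d b<d a≄b e → a≄b (ev-injective a b a<d b<d
      (*-cancelˡ ev≉0 (trans (sym (ev-reduce g a)) (trans (ev-cong e) (ev-reduce g b))))))
      nonzeroPolys-DegLt nonzeroPolys-unique

    module _ {m ℓm} (M : CommutativeMonoid m ℓm) where
      private module M = CommutativeMonoid M
      open Fold P.setoid M

      -- Generic in the monoid because both instances occur: products for the theorems of Fermat and
      -- Wilson, sums for the weighted sums.
      fold-reduce : ∀ {f} → (∀ {x y} → x ≋ y → f x M.≈ f y) →
                    fold (λ a → f (reduce g a)) nonzeroPolys M.≈ fold f nonzeroPolys
      fold-reduce f-cong = fold-permute f-cong (reduce g) nonzeroPolys reduce-∈ reduce-injective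

  -- First and second derivatives at θ.

  δ : Pol → Carrier
  δ f = ev (deriv f)

  δ² : Pol → Carrier
  δ² f = ev (deriv (deriv f))

  δ-+ : ∀ f g → δ (f +P g) ≈ δ f + δ g
  δ-+ f g = trans (ev-cong (deriv-+ f g)) (ev-+ (deriv f) (deriv g))

  δ-* : ∀ f g → δ (f *P g) ≈ δ f * ev g + ev f * δ g
  δ-* f g = trans (ev-cong (deriv-* f g)) (trans (ev-+ (deriv f *P g) (f *P deriv g))
    (+-cong (ev-* (deriv f) g) (ev-* f (deriv g))))

  δ²-* : ∀ f g → δ² (f *P g) ≈ (δ² f * ev g + δ f * δ g) + (δ f * δ g + ev f * δ² g)
  δ²-* f g = trans (ev-cong (deriv-cong (deriv-* f g))) (trans (δ-+ (deriv f *P g) (f *P deriv g))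
    (+-cong (δ-* (deriv f) g) (δ-* f (deriv g))))

  0<d : 0 < d
  0<d = positive cs (proj₁ irr)
    where
    positive : ∀ {n} (cs : Vec RK.Carrier n) → ¬ DegLt (monic cs) 1 → 0 < n
    positive Vec.[]       nonconst = ⊥-elim (nonconst λ { (suc n) _ → RK.refl })
    positive (_ Vec.∷ cs) _        = s≤s z≤n

  -- The theorems of Fermat and Wilson modulo ℘.

  private
    module Mul = Fold P.setoid *-commutativeMonoid
    module Add = Fold P.setoid +-commutativeMonoid

    M : ℕ
    M = length nonzeroPolys

  ∏ev : Carrier
  ∏ev = Mul.fold ev nonzeroPolys

  ∏ev≉0 : ¬ (∏ev ≈ 0#)
  ∏ev≉0 = fold≉0 nonzeroPolys-ev≉0
    where
    fold≉0 : ∀ {xs} → All (λ p → ¬ (ev p ≈ 0#)) xs → ¬ (Mul.fold ev xs ≈ 0#)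
    fold≉0 []       = 1≉0
    fold≉0 (e ∷ es) = *-≉0 e (fold≉0 es)

  ∏-scaled : ∀ g → ¬ (ev g ≈ 0#) → Mul.fold (λ a → ev g * ev a) nonzeroPolys ≈ ∏ev
  ∏-scaled g ev≉0 = trans (Mul.fold-cong (All.universal (λ a → sym (ev-reduce g a)) nonzeroPolys))
    (Permutation.fold-reduce g ev≉0 *-commutativeMonoid ev-cong)

  -- Euler's argument: multiplying all residues by `g` leaves their product unchanged, yet pulls out
  -- one factor g(θ) for each of them.
  fermat-unit : ∀ g → ¬ (ev g ≈ 0#) → ev g ** M ≈ 1#
  fermat-unit g ev≉0 = *-cancelˡ ∏ev≉0 (begin
    ∏ev * ev g ** M
      ≈⟨ *-comm _ _ ⟩
    ev g ** M * ∏ev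
      ≈⟨ *-congʳ (sym (Mul.fold-const (ev g) nonzeroPolys)) ⟩
    Mul.fold (λ _ → ev g) nonzeroPolys * ∏ev
      ≈⟨ sym (Mul.fold-∙ (λ _ → ev g) ev nonzeroPolys) ⟩
    Mul.fold (λ a → ev g * ev a) nonzeroPolys
      ≈⟨ ∏-scaled g ev≉0 ⟩
    ∏ev
      ≈⟨ sym (*-identityʳ _) ⟩
    ∏ev * 1# ∎)
    where open ≈-R

  fermat : ∀ g → ev g ** (q ^ d) ≈ ev g
  fermat g = trans (reflexive (≡.cong (ev g **_) (≡.sym length-nonzeroPolys))) power
    where
    power : ev g ** suc M ≈ ev g
    power with ev g ≟ 0#
    ... | yes ev≈0 = trans (*-congʳ ev≈0) (trans (zeroˡ _) (sym ev≈0))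
    ... | no ev≉0  = trans (*-congˡ (fermat-unit g ev≉0)) (*-identityʳ _)

  -- Shows that `M` is positive, so that X^M - 1 has its constant and leading coefficients in
  -- different places.
  1P-∈ : Any (1P ≋_) nonzeroPolys
  1P-∈ = nonzeroPolys-complete 1P (λ { zero d≤0 → ⊥-elim (ℕₚ.<⇒≱ 0<d d≤0) ; (suc n) _ → RK.refl })
    (λ e → FK.0≉1 (RK.sym (at e 0)))

  -- The values ev a are the roots of X^M − 1, so X^M − 1 = ∏ (X − ev a); evaluate at 0.
  wilson : ∏ev ≈ - 1#
  wilson = from-size (length-∈ 1P-∈)
    where
    length-∈ : ∀ {xs} → Any (1P ≋_) xs → Σ ℕ λ n → length xs ≡ suc n
    length-∈ {_ ∷ xs} _ = length xs , ≡.refl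

    ev-1 : ev (-P 1P) ≈ - 1#
    ev-1 = trans (ev-neg 1P) (-‿cong ev-1P)

    product-map : ∀ (f : Carrier → Carrier) xs → product (map f (map ev xs)) ≡ Mul.fold (λ a → f (ev a)) xs
    product-map f []       = ≡.refl
    product-map f (x ∷ xs) = ≡.cong (f (ev x) *_) (product-map f xs)

    from-size : (Σ ℕ λ n → M ≡ suc n) → ∏ev ≈ - 1#
    from-size (n , M≡1+n) = begin
      ∏ev
        -- Multiplication by -1 permutes the residues, so each factor `ev a` may be replaced by
        -- `0# - ev a`; no sign (-1)^M has to be evaluated.
        ≈⟨ sym (∏-scaled (-P 1P) (λ e → 1≉0 (trans (S.solve 1 (λ x → x := :- (:- x)) refl 1#)
             (trans (-‿cong (trans (sym ev-1) e)) (S.solve 0 (:- :0 := :0) refl))))) ⟩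
      Mul.fold (λ a → ev (-P 1P) * ev a) nonzeroPolys
        ≈⟨ Mul.fold-cong (All.universal (λ a → trans (*-congʳ ev-1)
             (S.solve 1 (λ x → :- :1 :* x := :0 :- x) refl (ev a))) nonzeroPolys) ⟩
      Mul.fold (λ a → 0# - ev a) nonzeroPolys
        ≡⟨ ≡.sym (product-map (λ r → 0# - r) nonzeroPolys) ⟩
      product (map (λ r → 0# - r) (map ev nonzeroPolys))
        ≈⟨ sym (monic-split v (map ev nonzeroPolys) (≡.trans (length-map ev nonzeroPolys) M≡1+n)
             (AllPairsₚ.map⁺ (AllPairs-refine (λ {a} {b} a<d b<d a≄b e → a≄b (ev-injective a b a<d b<d e))
               nonzeroPolys-DegLt nonzeroPolys-unique))
             (Allₚ.map⁺ (All.map (λ {a} → v-root a) nonzeroPolys-ev≉0)) 0#) ⟩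
      - 1# + 0# * B.eval (B.monic (Vec.replicate n 0#)) 0#
        ≈⟨ trans (+-congˡ (zeroˡ _)) (+-identityʳ _) ⟩
      - 1# ∎
      where
      open ≈-R
      open S
      -- X^(n+1) - 1: n zeros between -1 and the leading 1 that `monic` appends.
      v : Vec Carrier (suc n)
      v = (- 1#) Vec.∷ Vec.replicate n 0#
      v-root : ∀ a → ¬ (ev a ≈ 0#) → B.eval (B.monic v) (ev a) ≈ 0#
      v-root a ev≉0 = begin
        - 1# + ev a * B.eval (B.monic (Vec.replicate n 0#)) (ev a)
          ≈⟨ +-congˡ (*-congˡ (monic-X^ n (ev a))) ⟩
        - 1# + ev a ** suc n
          ≡⟨ ≡.cong (λ m → - 1# + ev a ** m) (≡.sym M≡1+n) ⟩
        - 1# + ev a ** M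
          ≈⟨ trans (+-congˡ (fermat-unit a ev≉0)) (-‿inverseˡ 1#) ⟩
        0# ∎

  -- Weighted sums over the residues and the logarithmic derivative.

  private
    weight : Pol → Carrier
    weight a = inv (ev a)

    weighted : (Pol → Carrier) → Carrier
    weighted f = Add.fold (λ a → f a * weight a) nonzeroPolys

  -- The value of F_d′/F_d at θ, which is the sum S.
  logDeriv : Carrier
  logDeriv = weighted δ

  fold-*ˡ : ∀ u f xs → Add.fold (λ a → u * f a) xs ≈ u * Add.fold f xs
  fold-*ˡ u f []       = sym (zeroʳ u)
  fold-*ˡ u f (x ∷ xs) = trans (+-congˡ (fold-*ˡ u f xs)) (sym (distribˡ _ _ _))

  ev-prodP : ∀ xs → ev (prodP xs) ≈ Mul.fold ev xs
  ev-prodP []       = ev-1P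
  ev-prodP (a ∷ as) = trans (ev-* a (prodP as)) (*-congˡ (ev-prodP as))

  δ-prodP : ∀ {xs} → All (λ a → ¬ (ev a ≈ 0#)) xs →
            δ (prodP xs) ≈ ev (prodP xs) * Add.fold (λ a → δ a * weight a) xs
  δ-prodP []                    = sym (zeroʳ _)
  δ-prodP {a ∷ as} (a≉0 ∷ as≉0) = begin
    δ (a *P p)
      ≈⟨ trans (δ-* a p) (+-congˡ (*-congˡ (δ-prodP as≉0))) ⟩
    δ a * ev p + ev a * (ev p * s)
      ≈⟨ +-congʳ (sym (trans (*-congʳ (*-inv a≉0)) (*-identityˡ _))) ⟩
    ev a * weight a * (δ a * ev p) + ev a * (ev p * s)
      ≈⟨ S.solve 5 (λ x w y z s → x :* w :* (y :* z) :+ x :* (z :* s) := (x :* z) :* (y :* w :+ s)) refl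
           (ev a) (weight a) (δ a) (ev p) s ⟩
    (ev a * ev p) * (δ a * weight a + s)
      ≈⟨ *-congʳ (sym (ev-* a p)) ⟩
    ev (a *P p) * (δ a * weight a + s) ∎
    where
    open ≈-R
    open S
    p = prodP as
    s = Add.fold (λ a → δ a * weight a) as

  -- Every term is 1 and there are `M` of them; M + 1 = q^d is zero in `K`, hence in `L`. This is
  -- where the -1 in `δ℘*Λ` comes from.
  weighted-ev : weighted ev ≈ - 1#
  weighted-ev = begin
    weighted ev
      ≈⟨ Add.fold-cong (All.map *-inv nonzeroPolys-ev≉0) ⟩
    Add.fold (λ _ → 1#) nonzeroPolys
      ≈⟨ trans (Add.fold-const 1# nonzeroPolys) (BT.×≈ntimes M 1#) ⟩
    B.ntimes M 1#
      ≈⟨ S.solve 2 (λ e x → x := :- e :+ (e :+ x)) refl 1# _ ⟩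
    - 1# + B.ntimes (suc M) 1#
      ≈⟨ +-congˡ (trans (reflexive (≡.cong (λ n → B.ntimes n 1#) length-nonzeroPolys)) q^d·1≈0) ⟩
    - 1# + 0#
      ≈⟨ +-identityʳ _ ⟩
    - 1# ∎
    where
    open ≈-R
    open S
    q^d·1≈0 : B.ntimes (q ^ d) 1# ≈ 0#
    q^d·1≈0 = trans (BT.ntimes-cong (q ^ d) (sym 1#-homo)) (trans (sym (ι-ntimes (q ^ d) RK.1#))
      (trans (⟦⟧-cong (KT.card^·1≈0 0<d)) 0#-homo))

  -- For a linear g, deg (g a) ≤ d, so ga = λ ℘ + reduce g a with λ constant; summing a derivative of this
  -- identity with weights 1 / ev a, the terms in reduce g a and in g a′ cancel.
  module Linear (s : RK.Carrier) (ev≉0 : ¬ (ev (s ∷ 1P) ≈ 0#)) where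
    g : Pol
    g = s ∷ 1P

    lead : Pol → Pol
    lead a = quot cs (g *P a)

    -- `lead a *P ℘` is the difference of `g *P a` and its residue, of degree at most `d`; the monic
    -- factor `℘` already uses up that degree.
    lead-constant : ∀ a → DegLt a d → DegLt (lead a) 1
    lead-constant a a<d = *-monic-DegLt cs 1 (lead a) (DegLt-cong eq
      (DegLt-+ (g *P a) (-P reduce g a)
        (DegLt-+ (scale s a) (RK.0# ∷ (1P *P a))
          (λ n d<n → RK.trans (coeff-scale s a n) (RK.trans (RK.*-congˡ (a<d n (ℕₚ.<⇒≤ d<n))) (RK.zeroʳ s)))
          (λ { (suc n) (s≤s d≤n) → RK.trans (at (*P-identityˡ a) n) (a<d n d≤n) }))
        (DegLt-neg (reduce g a) (DegLt-suc {reduce g a} (toList-DegLt (rem cs (g *P a)))))))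
      where
      open ≋-R
      open PS
      eq : ((g *P a) -P reduce g a) ≋ (lead a *P ℘)
      eq = begin
        (g *P a) -P reduce g a
          ≈⟨ P.+-congʳ { -P reduce g a} (division cs (g *P a)) ⟩
        ((lead a *P ℘) +P reduce g a) -P reduce g a
          ≈⟨ PS.solve 2 (λ x y → x :+ y :- y := x) ≋-refl (lead a *P ℘) (reduce g a) ⟩
        lead a *P ℘ ∎

    deriv-step : ∀ a → DegLt a d → (a +P (g *P deriv a)) ≋ ((lead a *P deriv ℘) +P deriv (reduce g a))
    deriv-step a a<d = begin
      a +P (g *P deriv a)
        ≈⟨ PS.solve 2 (λ a y → a :+ y := :1 :* a :+ y) ≋-refl a _ ⟩
      (1P *P a) +P (g *P deriv a)
        ≈⟨ P.+-congʳ (*P-congʳ 1P (deriv g) a (∷-cong (RK.sym (RK.+-identityʳ _)) ≋-refl)) ⟩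
      (deriv g *P a) +P (g *P deriv a)
        ≈⟨ ≋-sym (deriv-* g a) ⟩
      deriv (g *P a)
        ≈⟨ deriv-cong (division cs (g *P a)) ⟩
      deriv ((lead a *P ℘) +P reduce g a)
        ≈⟨ deriv-+ (lead a *P ℘) (reduce g a) ⟩
      deriv (lead a *P ℘) +P deriv (reduce g a)
        ≈⟨ P.+-congʳ (≋-trans (deriv-* (lead a) ℘)
             (P.+-congʳ (*P-congʳ (deriv (lead a)) [] ℘ (DegLt-0 (deriv-DegLt (lead a) (lead-constant a a<d)))))) ⟩
      (lead a *P deriv ℘) +P deriv (reduce g a) ∎
      where
      open ≋-R
      open PS

    deriv²-step : ∀ a → DegLt a d →
      ((deriv a +P deriv a) +P (g *P deriv (deriv a))) ≋ ((lead a *P deriv (deriv ℘)) +P deriv (deriv (reduce g a)))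
    deriv²-step a a<d = begin
      (deriv a +P deriv a) +P (g *P deriv (deriv a))
        ≈⟨ PS.solve 2 (λ a y → a :+ a :+ y := a :+ (:1 :* a :+ y)) ≋-refl (deriv a) _ ⟩
      deriv a +P ((1P *P deriv a) +P (g *P deriv (deriv a)))
        ≈⟨ P.+-congˡ {deriv a} (P.+-congʳ (*P-congʳ 1P (deriv g) (deriv a) (∷-cong (RK.sym (RK.+-identityʳ _)) ≋-refl))) ⟩
      deriv a +P ((deriv g *P deriv a) +P (g *P deriv (deriv a)))
        ≈⟨ P.+-congˡ {deriv a} (≋-sym (deriv-* g (deriv a))) ⟩
      deriv a +P deriv (g *P deriv a)
        ≈⟨ ≋-sym (deriv-+ a (g *P deriv a)) ⟩
      deriv (a +P (g *P deriv a))
        ≈⟨ deriv-cong (deriv-step a a<d) ⟩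
      deriv ((lead a *P deriv ℘) +P deriv (reduce g a))
        ≈⟨ deriv-+ (lead a *P deriv ℘) (deriv (reduce g a)) ⟩
      deriv (lead a *P deriv ℘) +P deriv (deriv (reduce g a))
        ≈⟨ P.+-congʳ (≋-trans (deriv-* (lead a) (deriv ℘))
             (P.+-congʳ (*P-congʳ (deriv (lead a)) [] (deriv ℘) (DegLt-0 (deriv-DegLt (lead a) (lead-constant a a<d)))))) ⟩
      (lead a *P deriv (deriv ℘)) +P deriv (deriv (reduce g a)) ∎
      where
      open ≋-R
      open PS

    Λ : Carrier
    Λ = weighted (λ a → ev (lead a))

    -- Common core of both differentiations: `h`, `D`, `c` are `ev`, `δ`, `δ ℘` for the first and
    -- `δ + δ`, `δ²`, `δ² ℘` for the second. The sum `u * weighted D` arises on both sides, on the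
    -- right only after undoing the permutation, and is cancelled.
    sum-step : ∀ (h D : Pol → Carrier) c → (∀ {x y} → x ≋ y → D x ≈ D y) →
      (∀ a → DegLt a d → h a + ev g * D a ≈ ev (lead a) * c + D (reduce g a)) → weighted h ≈ c * Λ
    sum-step h D c D-cong step = +-cancelʳ (u * weighted D) (weighted h) (c * Λ) (begin
      weighted h + u * weighted D
        ≈⟨ +-congˡ (sym (fold-*ˡ u _ nonzeroPolys)) ⟩
      weighted h + Add.fold (λ a → u * (D a * weight a)) nonzeroPolys
        ≈⟨ sym (Add.fold-∙ _ _ nonzeroPolys) ⟩
      Add.fold (λ a → h a * weight a + u * (D a * weight a)) nonzeroPolys
        ≈⟨ Add.fold-cong (All.zipWith (λ {a} (a<d , a≉0) → termwise a a<d a≉0) (nonzeroPolys-DegLt , nonzeroPolys-ev≉0)) ⟩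
      Add.fold (λ a → c * (ev (lead a) * weight a) + u * (D (reduce g a) * weight (reduce g a))) nonzeroPolys
        ≈⟨ trans (Add.fold-∙ _ _ nonzeroPolys) (+-cong (fold-*ˡ c _ nonzeroPolys) (fold-*ˡ u _ nonzeroPolys)) ⟩
      c * Λ + u * Add.fold (λ a → D (reduce g a) * weight (reduce g a)) nonzeroPolys
        ≈⟨ +-congˡ (*-congˡ (Permutation.fold-reduce g ev≉0 +-commutativeMonoid
             (λ e → *-cong (D-cong e) (inv-cong (ev-cong e))))) ⟩
      c * Λ + u * weighted D ∎)
      where
      open ≈-R
      open S
      open Algebra.Properties.Ring ring using (+-cancelʳ)
      u = ev g
      termwise : ∀ a → DegLt a d → ¬ (ev a ≈ 0#) →
        h a * weight a + u * (D a * weight a) ≈ c * (ev (lead a) * weight a) + u * (D (reduce g a) * weight (reduce g a))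
      termwise a a<d a≉0 = begin
        h a * weight a + u * (D a * weight a)
          ≈⟨ S.solve 4 (λ h w u D → h :* w :+ u :* (D :* w) := (h :+ u :* D) :* w) refl (h a) (weight a) u (D a) ⟩
        (h a + u * D a) * weight a
          ≈⟨ *-congʳ (step a a<d) ⟩
        (ev (lead a) * c + D (reduce g a)) * weight a
          ≈⟨ S.solve 4 (λ l c D w → (l :* c :+ D) :* w := c :* (l :* w) :+ D :* w) refl (ev (lead a)) c (D (reduce g a)) (weight a) ⟩
        c * (ev (lead a) * weight a) + D (reduce g a) * weight a
          -- Rewrites 1/a(θ) as u / (u a(θ)), whose denominator is the value of `reduce g a`, so
          -- that the term depends on the permuted polynomial alone.
          ≈⟨ +-congˡ (*-congˡ (sym (trans (*-congˡ (inv-cong (ev-reduce g a))) (inv-*-cancel ev≉0 a≉0)))) ⟩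
        c * (ev (lead a) * weight a) + D (reduce g a) * (u * weight (reduce g a))
          ≈⟨ +-congˡ (S.solve 3 (λ D u w → D :* (u :* w) := u :* (D :* w)) refl (D (reduce g a)) u _) ⟩
        c * (ev (lead a) * weight a) + u * (D (reduce g a) * weight (reduce g a)) ∎

    δ℘*Λ : δ ℘ * Λ ≈ - 1#
    δ℘*Λ = trans (sym (sum-step ev δ (δ ℘) (λ e → ev-cong (deriv-cong e)) (λ a a<d → begin
      ev a + ev g * δ a                                 ≈⟨ +-congˡ (sym (ev-* g (deriv a))) ⟩
      ev a + ev (g *P deriv a)                          ≈⟨ sym (ev-+ a _) ⟩
      ev (a +P (g *P deriv a))                          ≈⟨ ev-cong (deriv-step a a<d) ⟩
      ev ((lead a *P deriv ℘) +P deriv (reduce g a))    ≈⟨ ev-+ (lead a *P deriv ℘) _ ⟩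
      ev (lead a *P deriv ℘) + δ (reduce g a)           ≈⟨ +-congʳ (ev-* (lead a) (deriv ℘)) ⟩
      ev (lead a) * δ ℘ + δ (reduce g a)                ∎))) weighted-ev
      where open ≈-R

    2*logDeriv : logDeriv + logDeriv ≈ δ² ℘ * Λ
    2*logDeriv = begin
      logDeriv + logDeriv
        ≈⟨ sym (Add.fold-∙ _ _ nonzeroPolys) ⟩
      Add.fold (λ a → δ a * weight a + δ a * weight a) nonzeroPolys
        ≈⟨ Add.fold-cong (All.universal (λ a → sym (distribʳ (weight a) (δ a) (δ a))) nonzeroPolys) ⟩
      weighted (λ a → δ a + δ a)
        ≈⟨ sum-step (λ a → δ a + δ a) δ² (δ² ℘) (λ e → ev-cong (deriv-cong (deriv-cong e))) (λ a a<d → begin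
             δ a + δ a + ev g * δ² a
               ≈⟨ +-cong (sym (ev-+ (deriv a) (deriv a))) (sym (ev-* g (deriv (deriv a)))) ⟩
             ev (deriv a +P deriv a) + ev (g *P deriv (deriv a))
               ≈⟨ sym (ev-+ (deriv a +P deriv a) _) ⟩
             ev ((deriv a +P deriv a) +P (g *P deriv (deriv a)))
               ≈⟨ ev-cong (deriv²-step a a<d) ⟩
             ev ((lead a *P deriv (deriv ℘)) +P deriv (deriv (reduce g a)))
               ≈⟨ trans (ev-+ (lead a *P deriv (deriv ℘)) _) (+-congʳ (ev-* (lead a) (deriv (deriv ℘)))) ⟩
             ev (lead a) * δ² ℘ + δ² (reduce g a) ∎) ⟩
      δ² ℘ * Λ ∎
      where open ≈-R

  -- t and t + 1 differ by 1 and cannot both vanish at θ; t fails only when θ = 0.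
  nonvanishing-linear : Σ RK.Carrier λ s → ¬ (ev (s ∷ 1P) ≈ 0#)
  nonvanishing-linear with ev (RK.0# ∷ 1P) ≟ 0#
  ... | no X≉0  = RK.0# , X≉0
  ... | yes X≈0 = RK.1# , λ 1+X≈0 → 1≉0 (begin
    1#                           ≈⟨ sym ev-1P ⟩
    ev 1P                        ≈⟨ sym (+-identityʳ _) ⟩
    ev 1P + 0#                   ≈⟨ +-congˡ (sym X≈0) ⟩
    ev 1P + ev X                 ≈⟨ sym (ev-+ 1P X) ⟩
    ev (1P +P X)                 ≈⟨ ev-cong {1P +P X} {RK.1# ∷ 1P} (∷-cong (RK.+-identityʳ RK.1#) ≋-refl) ⟩
    ev (RK.1# ∷ 1P)              ≈⟨ 1+X≈0 ⟩
    0#                           ∎)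
    where open ≈-R

  open Linear (proj₁ nonvanishing-linear) (proj₂ nonvanishing-linear) using (Λ; δ℘*Λ; 2*logDeriv)

  -1≉0 : ¬ (- 1# ≈ 0#)
  -1≉0 e = 1≉0 (begin
    1#         ≈⟨ S.solve 1 (λ x → x := :- (:- x)) refl 1# ⟩
    - (- 1#)   ≈⟨ -‿cong e ⟩
    - 0#       ≈⟨ S.solve 0 (:- :0 := :0) refl ⟩
    0#         ∎)
    where open ≈-R
          open S

  δ℘≉0 : ¬ (δ ℘ ≈ 0#)
  δ℘≉0 e = -1≉0 (trans (sym δ℘*Λ) (trans (*-congʳ e) (zeroˡ _)))

  Λ≉0 : ¬ (Λ ≈ 0#)
  Λ≉0 e = -1≉0 (trans (sym δ℘*Λ) (trans (*-congˡ e) (zeroʳ _)))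

  -- Divisibility over `L`, and F_d to first order at θ.

  ℘L : B.Pol
  ℘L = map ι ℘

  divisible⇒root : ∀ f → ℘L B.∣P map ι f → ev f ≈ 0#
  divisible⇒root f (k , e) = trans (BT.eval-cong (map ι f) (℘L B.*P k) θ BT.⟪ e ⟫)
    (trans (BT.eval-* ℘L k θ) (trans (*-congʳ root) (zeroˡ _)))

  root⇒∣ : ∀ f → ev f ≈ 0# → ℘L B.∣P map ι f
  root⇒∣ f ev≈0 = map ι (quot cs f) , BT.at (BT.≋-trans (map-cong (root⇒divisible f ev≈0)) (map-* ℘ (quot cs f)))

  -- By uniqueness of quotients an exact division over `L` may be carried out over `K`; this keeps
  -- the iterated Fermat quotient inside the image of K[t].
  quot-exact-L : ∀ f g → f BT.≋ map ι (℘ *P g) → B.quot (Vec.map ι cs) f BT.≋ map ι g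
  quot-exact-L f g e = Division.quot-exact (FiniteField.ring L) (Vec.map ι cs) (map ι g)
    (BT.≋-trans e (BT.≋-trans (map-* ℘ g) (BT.*P-congʳ ℘L (B.monic (Vec.map ι cs)) (map ι g) (map-monic cs))))

  -- Unfolds to the `F d` of the `Wilson` module, so `Cond0` applies to it without transport.
  F : Pol
  F = prodP nonzeroPolys

  ev-F : ev F ≈ - 1#
  ev-F = trans (ev-prodP nonzeroPolys) wilson

  δ-F : δ F ≈ - logDeriv
  δ-F = trans (δ-prodP nonzeroPolys-ev≉0) (trans (*-congʳ ev-F)
    (S.solve 1 (λ x → :- :1 :* x := :- x) refl logDeriv))
    where open S

  -- Fermat quotients and their derivatives at θ.

  fermatQuotient : Pol → Pol
  fermatQuotient f = quot cs ((f ^P (q ^ d)) -P f)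

  fermat-divisible : ∀ f → ((f ^P (q ^ d)) -P f) ≋ (℘ *P fermatQuotient f)
  fermat-divisible f = root⇒divisible _ (trans (ev-+ (f ^P (q ^ d)) (-P f))
    (trans (+-cong (trans (ev-^ f (q ^ d)) (fermat f)) (ev-neg f)) (-‿inverseʳ _)))

  -- Allows `a` to be merely equal to an image of K[t], so that the result can be fed back into
  -- itself for the second quotient.
  fermatQuotient-L : ∀ a f → a BT.≋ map ι f →
    B.quot (Vec.map ι cs) ((a B.^P (q ^ d)) B.-P a) BT.≋ map ι (fermatQuotient f)
  fermatQuotient-L a f e = quot-exact-L _ (fermatQuotient f) (begin
    (a B.^P (q ^ d)) B.-P a
      ≈⟨ BT.+P-cong {p = a B.^P (q ^ d)} (power (q ^ d)) (BT.-P-cong e) ⟩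
    (map ι f B.^P (q ^ d)) B.-P map ι f
      ≈⟨ BT.≋-sym (BT.≋-trans (map-+ (f ^P (q ^ d)) (-P f)) (BT.+P-cong (map-^ f (q ^ d)) (map-neg f))) ⟩
    map ι ((f ^P (q ^ d)) -P f)
      ≈⟨ map-cong (fermat-divisible f) ⟩
    map ι (℘ *P fermatQuotient f) ∎)
    where
    open Relation.Binary.Reasoning.Setoid (CommutativeRing.setoid BT.polyRing)
    power : ∀ n → (a B.^P n) BT.≋ (map ι f B.^P n)
    power zero    = BT.≋-refl
    power (suc n) = CommutativeRing.*-cong BT.polyRing {a} {map ι f} e (power n)

  -- The power has derivative zero, because its exponent q^d is zero in `K`. `length-nonzeroPolys`
  -- presents that exponent as the successor which `deriv-^` expects.
  deriv-fermat : ∀ f → deriv (℘ *P fermatQuotient f) ≋ (-P deriv f)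
  deriv-fermat f = begin
    deriv (℘ *P fermatQuotient f)
      ≈⟨ deriv-cong (≋-sym (fermat-divisible f)) ⟩
    deriv ((f ^P (q ^ d)) -P f)
      ≈⟨ ≋-trans (deriv-+ (f ^P (q ^ d)) (-P f)) (+P-cong deriv-power (deriv-neg f)) ⟩
    -P deriv f ∎
    where
    open ≋-R
    deriv-power : deriv (f ^P (q ^ d)) ≋ []
    deriv-power = ≋-trans
      (≋-trans (P.reflexive (≡.cong (λ n → deriv (f ^P n)) (≡.sym length-nonzeroPolys))) (deriv-^ f M))
      (*P-congʳ (const (ntimes (suc M) RK.1#)) [] ((f ^P M) *P deriv f) (≋-trans (∷-cong
        (RK.trans (RK.reflexive (≡.cong (λ n → ntimes n RK.1#) length-nonzeroPolys)) (KT.card^·1≈0 0<d)) ≋-refl) shift-[]))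

  δ-fermat : ∀ f → δ ℘ * ev (fermatQuotient f) ≈ - δ f
  δ-fermat f = begin
    δ ℘ * ev Q
      ≈⟨ S.solve 2 (λ x y → x := x :+ :0 :* y) refl _ (δ Q) ⟩
    δ ℘ * ev Q + 0# * δ Q
      ≈⟨ +-congˡ (*-congʳ (sym root)) ⟩
    δ ℘ * ev Q + ev ℘ * δ Q
      ≈⟨ sym (δ-* ℘ Q) ⟩
    δ (℘ *P Q)
      ≈⟨ trans (ev-cong (deriv-fermat f)) (ev-neg (deriv f)) ⟩
    - δ f ∎
    where
    open ≈-R
    open S
    Q = fermatQuotient f

  Q₁ Q₂ : Pol
  Q₁ = fermatQuotient X
  Q₂ = fermatQuotient Q₁

  -- Compare `δ℘*Λ`: both `ev Q₁` and `Λ` are -1/℘′(θ).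
  δ℘*evQ₁ : δ ℘ * ev Q₁ ≈ - 1#
  δ℘*evQ₁ = trans (δ-fermat X) (-‿cong (trans (ev-cong {deriv X} {1P} (∷-cong (RK.+-identityʳ RK.1#) ≋-refl)) ev-1P))

  -- The right-hand side is the second derivative of -t; on the left ℘ Q₁″ drops out because ℘
  -- vanishes at θ.
  δ²℘*evQ₁ : δ² ℘ * ev Q₁ + (δ ℘ * δ Q₁ + δ ℘ * δ Q₁) ≈ 0#
  δ²℘*evQ₁ = begin
    δ² ℘ * ev Q₁ + (δ ℘ * δ Q₁ + δ ℘ * δ Q₁)
      ≈⟨ S.solve 3 (λ x y z → x :+ (y :+ y) := x :+ y :+ (y :+ :0 :* z)) refl _ _ (δ² Q₁) ⟩
    δ² ℘ * ev Q₁ + δ ℘ * δ Q₁ + (δ ℘ * δ Q₁ + 0# * δ² Q₁)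
      ≈⟨ +-congˡ (+-congˡ (*-congʳ (sym root))) ⟩
    δ² ℘ * ev Q₁ + δ ℘ * δ Q₁ + (δ ℘ * δ Q₁ + ev ℘ * δ² Q₁)
      ≈⟨ sym (δ²-* ℘ Q₁) ⟩
    δ² (℘ *P Q₁)
      ≈⟨ ev-cong (≋-trans (deriv-cong (deriv-fermat X)) (deriv-neg (deriv X))) ⟩
    0# ∎
    where open ≈-R
          open S

  -- The equivalences.

  private
    module W = Wilson K L ι cs θ

  Q℘²t≋ : W.Q℘²t BT.≋ map ι Q₂
  Q℘²t≋ = fermatQuotient-L (W.Q℘ B.X) Q₁
    (fermatQuotient-L B.X X (BT.∷-cong (sym 0#-homo) (BT.∷-cong (sym 1#-homo) BT.≋-refl)))

  ev-Q℘²t : B.eval W.Q℘²t θ ≈ ev Q₂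
  ev-Q℘²t = BT.eval-cong W.Q℘²t (map ι Q₂) θ Q℘²t≋

  ii⇔ii' : W.Cond-ii ⇔ W.Cond-ii'
  ii⇔ii' = mk⇔
    (λ (k , e) → trans (BT.eval-cong W.Q℘²t (℘L B.*P k) θ BT.⟪ e ⟫)
                   (trans (BT.eval-* ℘L k θ) (trans (*-congʳ root) (zeroˡ _))))
    (λ e → let k , e' = root⇒∣ Q₂ (trans (sym ev-Q℘²t) e) in k , BT.at (BT.≋-trans {q = map ι Q₂} {r = ℘L B.*P k} Q℘²t≋ BT.⟪ e' ⟫))

  i''⇔i' : W.Cond-i'' ⇔ W.Cond-i'
  i''⇔i' = mk⇔ (root⇒∣ W.℘'') (divisible⇒root W.℘'')

  -- ℘″ has degree below `d`, so `low-degree-root` turns its vanishing at θ into its vanishing.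
  i''⇔i : W.Cond-i'' ⇔ W.Cond-i
  i''⇔i = mk⇔
    (λ e → at (low-degree-root W.℘'' ℘''<d e))
    (λ e → ev-cong {W.℘''} {[]} ⟪ e ⟫)
    where
    ℘''<d : DegLt W.℘'' d
    ℘''<d = deriv-DegLt (deriv ℘) (DegLt-suc {deriv ℘} (deriv-DegLt ℘ (monic-DegLt cs)))

  module Odd (2∤q : ¬ (2 ∣ q)) where

    -- Oddness of q enters here: 1 + 1 is nonzero in `K`, and a field embedding keeps it nonzero in
    -- `L`.
    double≈0 : ∀ {x} → x + x ≈ 0# → x ≈ 0#
    double≈0 {x} e = *-≈0 2≉0 (trans (S.solve 1 (λ x → (:1 :+ :1) :* x := x :+ x) refl x) e)
      where
      open S
      2≉0 : ¬ (1# + 1# ≈ 0#)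
      2≉0 e = ι-≉0 (KT.1+1≉0 2∤q) (trans (+-homo RK.1# RK.1#) (trans (+-cong 1#-homo 1#-homo) e))

    double-≈0 : ∀ {x} → x ≈ 0# → x + x ≈ 0#
    double-≈0 e = trans (+-cong e e) (+-identityˡ 0#)

    logDeriv≈0⇒i'' : logDeriv ≈ 0# → W.Cond-i''
    logDeriv≈0⇒i'' e = *-≈0 Λ≉0 (trans (*-comm _ _) (trans (sym 2*logDeriv) (double-≈0 e)))

    i''⇒logDeriv≈0 : W.Cond-i'' → logDeriv ≈ 0#
    i''⇒logDeriv≈0 e = double≈0 (trans 2*logDeriv (trans (*-congʳ e) (zeroˡ _)))

    0⇔i'' : W.Cond0 ⇔ W.Cond-i''
    0⇔i'' = mk⇔ to from
      where
      open S
      neg-zero : ∀ {x} → - x ≈ 0# → x ≈ 0#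
      neg-zero {x} e = trans (S.solve 1 (λ x → x := :- (:- x)) refl x) (trans (-‿cong e) (S.solve 0 (:- :0 := :0) refl))

      to : W.Cond0 → W.Cond-i''
      -- The cofactor `k` is only known to lie in L[t], so the multiple of ℘² is differentiated
      -- there instead of through `δ`; both terms keep a factor ℘(θ) = 0.
      to (k , e) = logDeriv≈0⇒i'' (neg-zero (begin
        - logDeriv
          ≈⟨ sym δ-F ⟩
        δ F
          ≈⟨ BT.eval-cong _ _ θ (BT.≋-trans (map-deriv F) (BT.≋-sym (BT.+P-identityʳ _))) ⟩
        B.eval (B.deriv (map ι F) B.+P B.deriv B.1P) θ
          ≈⟨ BT.eval-cong _ _ θ (BT.≋-trans (BT.≋-sym (BT.deriv-+ (map ι F) B.1P)) (BT.deriv-cong F+1)) ⟩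
        B.eval (B.deriv (℘L B.*P (℘L B.*P k))) θ
          ≈⟨ BT.eval-cong _ _ θ (BT.deriv-* ℘L (℘L B.*P k)) ⟩
        B.eval ((B.deriv ℘L B.*P (℘L B.*P k)) B.+P (℘L B.*P B.deriv (℘L B.*P k))) θ
          ≈⟨ trans (BT.eval-+ (B.deriv ℘L B.*P (℘L B.*P k)) _ θ) (+-cong
               (trans (BT.eval-* (B.deriv ℘L) (℘L B.*P k) θ) (*-congˡ (trans (BT.eval-* ℘L k θ) (*-congʳ root))))
               (trans (BT.eval-* ℘L _ θ) (*-congʳ root))) ⟩
        B.eval (B.deriv ℘L) θ * (0# * B.eval k θ) + 0# * B.eval (B.deriv (℘L B.*P k)) θ
          ≈⟨ S.solve 3 (λ x y z → x :* (:0 :* y) :+ :0 :* z := :0) refl _ _ _ ⟩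
        0# ∎))
        where
        open ≈-R
        F+1 : (map ι F B.+P B.1P) BT.≋ (℘L B.*P (℘L B.*P k))
        F+1 = BT.≋-trans {q = (℘L B.^P 2) B.*P k} BT.⟪ e ⟫ (PSL.solve 2 (λ p k → (p :*L (p :*L :1L)) :*L k :=L p :*L (p :*L k)) BT.≋-refl ℘L k)
          where
          module PSL = DifferenceSolver BT.polyRing
          open PSL using () renaming (_:*_ to _:*L_; _:=_ to _:=L_; :1 to :1L)

      from : W.Cond-i'' → W.Cond0
      -- The witness is the quotient of F_d + 1 by `℘` taken twice over `K`; `ev-F` makes the first
      -- division exact and `ev-g` the second.
      from e = map ι h , BT.at (begin
        map ι F B.+P B.1P                   ≈⟨ BT.≋-sym (BT.≋-trans (map-+ F 1P) (BT.+P-cong {p = map ι F} BT.≋-refl map-1P)) ⟩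
        map ι (F +P 1P)                     ≈⟨ map-cong square ⟩
        map ι ((℘ ^P 2) *P h)               ≈⟨ BT.≋-trans (map-* (℘ ^P 2) h) (BT.*P-congʳ _ _ (map ι h) (map-^ ℘ 2)) ⟩
        (℘L B.^P 2) B.*P map ι h            ∎)
        where
        open Relation.Binary.Reasoning.Setoid (CommutativeRing.setoid BT.polyRing)
        g = quot cs (F +P 1P)
        h = quot cs g

        F+1 : (F +P 1P) ≋ (℘ *P g)
        F+1 = root⇒divisible (F +P 1P) (trans (ev-+ F 1P) (trans (+-cong ev-F ev-1P) (-‿inverseˡ 1#)))

        -- At a simple root, differentiation reads off the cofactor: (℘ g)′(θ) = ℘′(θ) g(θ), and the
        -- left side is F_d′(θ) = -S.
        ev-g : ev g ≈ 0#
        ev-g = *-≈0 δ℘≉0 (≈-R.begin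
          δ ℘ * ev g                ≈-R.≈⟨ S.solve 2 (λ x y → x := x :+ :0 :* y) refl _ (δ g) ⟩
          δ ℘ * ev g + 0# * δ g     ≈-R.≈⟨ +-congˡ (*-congʳ (sym root)) ⟩
          δ ℘ * ev g + ev ℘ * δ g   ≈-R.≈⟨ sym (δ-* ℘ g) ⟩
          δ (℘ *P g)                ≈-R.≈⟨ ev-cong (deriv-cong (≋-sym F+1)) ⟩
          δ (F +P 1P)               ≈-R.≈⟨ δ-+ F 1P ⟩
          δ F + 0#                  ≈-R.≈⟨ trans (+-identityʳ _) δ-F ⟩
          - logDeriv                ≈-R.≈⟨ -‿cong (i''⇒logDeriv≈0 e) ⟩
          - 0#                      ≈-R.≈⟨ S.solve 0 (:- :0 := :0) refl ⟩
          0#                        ≈-R.∎)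

        square : (F +P 1P) ≋ ((℘ ^P 2) *P h)
        square = ≋-trans F+1 (≋-trans (P.*-congˡ {℘} (root⇒divisible g ev-g))
          (PS.solve 2 (λ p h → p :*K (p :*K h) :=K (p :*K (p :*K :1K)) :*K h) ≋-refl ℘ h))
          where
          open PS using () renaming (_:*_ to _:*K_; _:=_ to _:=K_; :1 to :1K)

    -- Both conditions amount to Q₁′(θ) = 0: `δ-fermat Q₁` ties it to Q₂(θ) and `δ²℘*evQ₁` to ℘″(θ),
    -- with the factors ℘′(θ), Q₁(θ) and 2 all nonzero.
    i''⇔ii' : W.Cond-i'' ⇔ W.Cond-ii'
    i''⇔ii' = mk⇔
      (λ e → trans ev-Q℘²t (*-≈0 δ℘≉0 (trans (δ-fermat Q₁) (trans (-‿cong (δQ₁≈0 e)) (S.solve 0 (:- :0 := :0) refl)))))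
      (λ e → *-≈0 evQ₁≉0 (trans (*-comm _ _) (begin
        δ² ℘ * ev Q₁
          ≈⟨ S.solve 2 (λ x y → x := x :+ (y :* :0 :+ y :* :0)) refl _ (δ ℘) ⟩
        δ² ℘ * ev Q₁ + (δ ℘ * 0# + δ ℘ * 0#)
          ≈⟨ +-congˡ (+-cong (*-congˡ (sym (δQ₁-zero e))) (*-congˡ (sym (δQ₁-zero e)))) ⟩
        δ² ℘ * ev Q₁ + (δ ℘ * δ Q₁ + δ ℘ * δ Q₁)
          ≈⟨ δ²℘*evQ₁ ⟩
        0# ∎)))
      where
      open ≈-R
      open S
      evQ₁≉0 : ¬ (ev Q₁ ≈ 0#)
      evQ₁≉0 e = -1≉0 (trans (sym δ℘*evQ₁) (trans (*-congˡ e) (zeroʳ _)))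

      δQ₁≈0 : W.Cond-i'' → δ Q₁ ≈ 0#
      δQ₁≈0 e = *-≈0 δ℘≉0 (double≈0 (begin
        δ ℘ * δ Q₁ + δ ℘ * δ Q₁
          ≈⟨ S.solve 2 (λ x y → x := :0 :* y :+ x) refl _ (ev Q₁) ⟩
        0# * ev Q₁ + (δ ℘ * δ Q₁ + δ ℘ * δ Q₁)
          ≈⟨ +-congʳ (*-congʳ (sym e)) ⟩
        δ² ℘ * ev Q₁ + (δ ℘ * δ Q₁ + δ ℘ * δ Q₁)
          ≈⟨ δ²℘*evQ₁ ⟩
        0# ∎))

      δQ₁-zero : W.Cond-ii' → δ Q₁ ≈ 0#
      δQ₁-zero e = begin
        δ Q₁                    ≈⟨ S.solve 1 (λ x → x := :- (:- x)) refl _ ⟩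
        - (- δ Q₁)              ≈⟨ -‿cong (sym (δ-fermat Q₁)) ⟩
        - (δ ℘ * ev Q₂)         ≈⟨ -‿cong (*-congˡ (trans (sym ev-Q℘²t) e)) ⟩
        - (δ ℘ * 0#)            ≈⟨ S.solve 1 (λ x → :- (x :* :0) := :0) refl _ ⟩
        0#                      ∎

    i''⇔iii : W.Cond-i'' ⇔ W.Cond-iii
    i''⇔iii = mk⇔ (λ e → double≈0 (trans (sym ℘''≈2℘[2]) e)) (λ e → trans ℘''≈2℘[2] (double-≈0 e))
      where
      module BD = Division (FiniteField.ring L)
      open ≈-R
      u = B.diffQ θ ℘L
      ℘''≈2℘[2] : δ² ℘ ≈ B.eval W.℘[2] θ + B.eval W.℘[2] θ
      ℘''≈2℘[2] = begin
        δ² ℘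
          ≈⟨ BT.eval-cong _ _ θ (BT.≋-trans (map-deriv (deriv ℘)) (BT.deriv-cong (map-deriv ℘))) ⟩
        B.eval (B.deriv (B.deriv ℘L)) θ
          ≈⟨ sym (BD.eval-deriv-diffQ θ ℘L) ⟩
        B.eval (B.deriv u) θ + B.eval (B.deriv u) θ
          ≈⟨ sym (+-cong (BD.eval-diffQ θ u) (BD.eval-diffQ θ u)) ⟩
        B.eval W.℘[2] θ + B.eval W.℘[2] θ ∎

    0⇔ii' : W.Cond0 ⇔ W.Cond-ii'
    0⇔ii' = i''⇔ii' ⇔-∘ 0⇔i''

    equivalences : W.AllEquivalent
    equivalences = i''⇔i ⇔-∘ 0⇔i'' , i''⇔i' ⇔-∘ 0⇔i'' , 0⇔i'' ,
                   ⇔-sym ii⇔ii' ⇔-∘ 0⇔ii' , 0⇔ii' , i''⇔iii ⇔-∘ 0⇔i''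

theorem3 : ∀ {c ℓ c' ℓ'} (K : FiniteField c ℓ) (L : FiniteField c' ℓ')
    (p k : ℕ) → Prime p → p ≢ 2 → FiniteField.card K ≡ p ^ suc k
    → (d : ℕ) → FiniteField.card L ≡ FiniteField.card K ^ d
    → (ι : CommutativeRing.Carrier (FiniteField.ring K) → CommutativeRing.Carrier (FiniteField.ring L))
    → IsFieldEmbedding K L ι
    → (cs : Vec (CommutativeRing.Carrier (FiniteField.ring K)) d)
    → Poly.Irreducible (FiniteField.ring K) (Poly.monic (FiniteField.ring K) cs)
    → (θ : CommutativeRing.Carrier (FiniteField.ring L))
    → CommutativeRing._≈_ (FiniteField.ring L) (Poly.eval (FiniteField.ring L) (Wilson.℘L K L ι cs θ) θ) (CommutativeRing.0# (FiniteField.ring L))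
    → Wilson.AllEquivalent K L ι cs θ
theorem3 K L p k isPrime p≢2 card≡ d _ ι hom cs irr θ root = Root.Odd.equivalences K L ι hom cs irr θ root
  (≡.subst (λ n → ¬ (2 ∣ n)) (≡.sym card≡) (odd-prime-power isPrime p≢2 (suc k)))
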